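{- Let $D\geq 2$ be an integer. Every $\left(\frac{6D+5}{3(D+1)},\frac{2}{3(D+1)}\right)$-sparse simple graph $G$ has a $(D,\mathrm{F})$-coloring, i.e. a partition $(M,F)$ of $V(G)$ such that $G[M]$ is a forest with maximum degree at most $D$ and $G[F]$ is a forest.
   Context: For $a>0$ and real $b$, a graph $H$ is $(a,b)$-sparse if it is loopless and for every $A\subseteq V(H)$ with $|A|\geq 2$, the induced subgraph $H[A]$ has at most $a|A|+b$ edges. -}

module Defs where

open import Data.Nat using (ℕ; zero; suc; _≤_; _*_; _+_)
open import Data.Fin using (Fin; toℕ)
open import Data.Fin.Subset using (Subset; _∈_; _∉_; ∣_∣; ∁)
open import Data.Fin.Subset.Properties using (_∈?_)
open import Data.List using (List; []; _∷_; _++_; length; allFin; map)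
open import Data.Nat.ListAction using (sum)
open import Data.List.Relation.Unary.All using (All)
open import Data.List.Relation.Unary.Unique.Propositional using (Unique)
open import Data.Product using (_×_)
open import Data.Empty using (⊥)
open import Data.Unit using (⊤)
open import Relation.Nullary using (Dec; yes; no; ¬_)
open import Relation.Nullary.Decidable using (_×-dec_)
open import Data.Nat.Properties using (_<?_)
open import Data.Integer using (+_)
import Data.Rational as ℚ

record Graph (n : ℕ) : Set₁ where
  field
    Adj      : Fin n → Fin n → Set
    adj?     : (u v : Fin n) → Dec (Adj u v)
    sym      : ∀ {u v} → Adj u v → Adj v u
    loopless : ∀ {u} → ¬ Adj u u
open Graph public

⟦_⟧ : {P : Set} → Dec P → ℕ
⟦ yes _ ⟧ = 1
⟦ no _ ⟧ = 0

edgesIn : {n : ℕ} → Graph n → Subset n → ℕ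
edgesIn {n} G A =
  sum (map (λ u → sum (map (λ v →
    ⟦ (toℕ u <? toℕ v) ×-dec ((u ∈? A) ×-dec ((v ∈? A) ×-dec adj? G u v)) ⟧)
    (allFin n))) (allFin n))

degIn : {n : ℕ} → Graph n → Subset n → Fin n → ℕ
degIn {n} G A v = sum (map (λ u → ⟦ (u ∈? A) ×-dec adj? G v u ⟧) (allFin n))

Sparse : {n : ℕ} → ℚ.ℚ → ℚ.ℚ → Graph n → Set
Sparse {n} a b G = (A : Subset n) → 2 ≤ ∣ A ∣ →
  (+ edgesIn G A) ℚ./ 1 ℚ.≤ a ℚ.* ((+ ∣ A ∣) ℚ./ 1) ℚ.+ b

Walk : {n : ℕ} → Graph n → List (Fin n) → Set
Walk G []           = ⊤
Walk G (x ∷ [])     = ⊤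
Walk G (x ∷ y ∷ xs) = Adj G x y × Walk G (y ∷ xs)

CycleIn : {n : ℕ} → Graph n → Subset n → Fin n → List (Fin n) → Set
CycleIn G A v₀ vs =
  Unique (v₀ ∷ vs) × (2 ≤ length vs) × All (_∈ A) (v₀ ∷ vs) ×
  Walk G (v₀ ∷ vs ++ v₀ ∷ [])

IsForest : {n : ℕ} → Graph n → Subset n → Set
IsForest G A = ∀ v₀ vs → ¬ CycleIn G A v₀ vs

MaxDegreeAtMost : {n : ℕ} → Graph n → Subset n → ℕ → Set
MaxDegreeAtMost G A D = ∀ v → v ∈ A → degIn G A v ≤ D

DFColoring : {n : ℕ} → Graph n → ℕ → Subset n → Set
DFColoring G D M = IsForest G M × MaxDegreeAtMost G M D × IsForest G (∁ M)

{-# OPTIONS --safe #-}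
-- Generalise by giving every vertex v a type j v ≤ D + 1, the number of M-neighbours it has
-- outside the graph (type D + 1 forces v into F).  With the potential
-- ρ(A) = (6D+5)|A| − 3(D+1)e(A) − 3 j(A), the claim becomes: ρ ≥ −2 on all sets gives a colouring.
-- Induct on the number of vertices.
--
-- Vertices of degree ≤ 1, or of degree 2 and type ≤ D, can be deleted.  Otherwise let A minimise ρ
-- among the proper subsets with at least two vertices.  Outside vertices have at most one
-- neighbour in A, so one may colour A, contract its F-part to a single vertex of type D + 1, and
-- raise the type of the outside neighbours of its M-part; the new graph is again simple, and it is
-- sparse if ρ(A) ≤ 3D.  If instead ρ ≥ 3D + 1 on all such subsets, a vertex of degree 3 and
-- type < D can be deleted after raising the types of its three neighbours by one, which is where
-- D ≥ 2 enters.  If nothing applies, each vertex contributes at most −1 to ρ, so there are at most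
-- two vertices, contradicting that all degrees are at least 2.
module Submission where

open import Defs
open import Data.Nat using (ℕ; zero; suc; _≤_; _<_; _*_; _+_; _∸_; _⊓_; z≤n; s≤s; _<ᵇ_; _≤?_; _<?_)
open import Data.Nat.Properties hiding (_≟_; _≤?_; _<?_)
open import Data.Nat.ListAction using () renaming (sum to sumᴸ)
open import Data.Nat.Tactic.RingSolver using (solve)
open import Data.Bool as Bool using (Bool; true; false; _∧_; _∨_; not; if_then_else_)
open import Data.Bool.Properties using (∧-conicalˡ; ∧-conicalʳ; ∨-zeroʳ; T-≡; ¬-not)
open import Data.Fin using (Fin; zero; suc; toℕ; _≟_)
open import Data.Fin.Properties using (toℕ-injective; any?; all?)
open import Data.Fin.Subset using (Subset; ∣_∣; ∁) renaming (_∈_ to _∈ₛ_)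
open import Data.Fin.Subset.Properties using (_∈?_; x∈∁p⇒x∉p; anySubset?)
open import Data.Vec as Vec using (lookup; tabulate)
open import Data.Vec.Properties using (lookup∘tabulate; []=⇒lookup; lookup⇒[]=)
open import Data.List using (List; []; _∷_; _++_; length; map; allFin) renaming (tabulate to tabulateᴸ)
open import Data.List.Properties using (map-tabulate)
open import Data.List.Relation.Unary.All as All using (All)
import Data.List.Relation.Unary.AllPairs as AllPairs
open import Data.List.Relation.Unary.Unique.Propositional using (Unique)
open import Data.Product using (Σ; _,_; _×_; proj₁; proj₂; ∃)
open import Data.Sum using (_⊎_; inj₁; inj₂; fromInj₂)
open import Data.Empty using (⊥; ⊥-elim)
open import Function using (_∘_; const)
open import Function.Bundles using (Equivalence)
open import Relation.Nullary using (Dec; yes; no; ¬_; does; contradiction)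
open import Relation.Nullary.Decidable using (dec-true; dec-false; _×-dec_; _⊎-dec_; _→-dec_)
open import Relation.Binary.Definitions using (tri<; tri≈; tri>)
open import Relation.Binary.PropositionalEquality using (_≡_; _≢_; _≗_; refl; trans; cong; cong₂; subst; subst₂; module ≡-Reasoning) renaming (sym to ≡-sym)
open import Algebra.Properties.CommutativeMonoid.Sum +-0-commutativeMonoid using (sum; sum-cong-≗; sum-replicate-zero; ∑-distrib-+; ∑-comm)
open import Algebra.Properties.Semiring.Sum +-*-semiring using (*-distribˡ-sum)

-- Linear arithmetic: add the hypotheses into x ≤ y; what remains is a semiring identity.
lin : ∀ {x y b c} k → x ≤ y → c + x ≡ b + y + k → b ≤ c
lin {x} {y} {b} {c} k x≤y eq = +-cancelʳ-≤ x b c (begin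
  b + x      ≤⟨ +-monoʳ-≤ b x≤y ⟩
  b + y      ≤⟨ m≤m+n (b + y) k ⟩
  b + y + k  ≡⟨ ≡-sym eq ⟩
  c + x      ∎)
  where open ≤-Reasoning

-- The statement of *-monoʳ-≤, in a form the ring solver can read.
scale : ∀ k {x y} → x ≤ y → k * x ≤ k * y
scale k = *-monoʳ-≤ k

[_] : Bool → ℕ
[ true ] = 1
[ false ] = 0

≮⇒<ᵇ≡false : ∀ {x y} → ¬ x < y → (x <ᵇ y) ≡ false
≮⇒<ᵇ≡false {x} {y} h with x <ᵇ y in eq
... | false = refl
... | true  = contradiction (<ᵇ⇒< x y (Equivalence.from T-≡ eq)) h

-- Vertex sets and weighted sums over them.

module VertexSets (n : ℕ) where

  VSet : Set
  VSet = Fin n → Bool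

  infix 4 _∈_ _⊆_ _≐_⊍_
  infixl 6 _∪_ _∖_
  infixl 7 _∩_

  _∈_ : Fin n → VSet → Set
  v ∈ P = P v ≡ true

  _⊆_ : VSet → VSet → Set
  P ⊆ Q = ∀ v → v ∈ P → v ∈ Q

  _∩_ _∪_ _∖_ : VSet → VSet → VSet
  (P ∩ Q) v = P v ∧ Q v
  (P ∪ Q) v = P v ∨ Q v
  (P ∖ Q) v = P v ∧ not (Q v)

  ∅ : VSet
  ∅ v = false

  ｛_｝ : Fin n → VSet
  ｛ r ｝ v = does (v ≟ r)

  -- Disjoint union: one equation between indicators states both covering and disjointness, and
  -- makes every weighted sum additive.
  record _≐_⊍_ (P X Y : VSet) : Set where
    field indicator : ∀ v → [ P v ] ≡ [ X v ] + [ Y v ]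
  open _≐_⊍_

  ∈∩ : ∀ P Q {v} → v ∈ P → v ∈ Q → v ∈ P ∩ Q
  ∈∩ P Q p q rewrite p | q = refl

  ∈∖ : ∀ P Q {v} → v ∈ P → Q v ≡ false → v ∈ P ∖ Q
  ∈∖ P Q p q rewrite p | q = refl

  ∩⊆ˡ : ∀ P Q → P ∩ Q ⊆ P
  ∩⊆ˡ P Q v = ∧-conicalˡ (P v) (Q v)

  ∩⊆ʳ : ∀ P Q → P ∩ Q ⊆ Q
  ∩⊆ʳ P Q v = ∧-conicalʳ (P v) (Q v)

  ∖⊆ : ∀ P Q → P ∖ Q ⊆ P
  ∖⊆ P Q v = ∧-conicalˡ (P v) (not (Q v))

  ∖∉ : ∀ P Q v → v ∈ P ∖ Q → Q v ≡ false
  ∖∉ P Q v p with P v | Q v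
  ... | true | false = refl

  ∪⊆ : ∀ {P Q R} → P ⊆ R → Q ⊆ R → P ∪ Q ⊆ R
  ∪⊆ {P} P⊆R Q⊆R v p with P v in eq
  ... | true  = P⊆R v eq
  ... | false = Q⊆R v p

  ∪⊇ˡ : ∀ P Q → P ⊆ P ∪ Q
  ∪⊇ˡ P Q v p rewrite p = refl

  ∈｛｝ : ∀ r → r ∈ ｛ r ｝
  ∈｛｝ r = dec-true (r ≟ r) refl

  ∈｛｝⇒≡ : ∀ r v → v ∈ ｛ r ｝ → v ≡ r
  ∈｛｝⇒≡ r v p with v ≟ r
  ... | yes eq = eq

  ∉｛｝ : ∀ r v → v ≢ r → ｛ r ｝ v ≡ false
  ∉｛｝ r v = dec-false (v ≟ r)

  ∉⇒≢ : ∀ P {u v} → u ∈ P → P v ≡ false → u ≢ v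
  ∉⇒≢ P p q refl with () ← trans (≡-sym p) q

  split-by : ∀ A P → P ≐ P ∩ A ⊍ P ∖ A
  split-by A P .indicator v with P v | A v
  ... | true  | true  = refl
  ... | true  | false = refl
  ... | false | _     = refl

  split-∪ : ∀ A Q → (∀ v → v ∈ Q → A v ≡ false) → A ∪ Q ≐ A ⊍ Q
  split-∪ A Q disj .indicator v with Q v in eq | A v in eq′
  ... | true  | true with () ← trans (≡-sym eq′) (disj v eq)
  ... | true  | false = refl
  ... | false | true  = refl
  ... | false | false = refl

  sum-mono : ∀ {m} {f g : Fin m → ℕ} → (∀ v → f v ≤ g v) → sum f ≤ sum g
  sum-mono {zero}  h = z≤n
  sum-mono {suc m} h = +-mono-≤ (h zero) (sum-mono (h ∘ suc))

  term≤sum : ∀ {m} (f : Fin m → ℕ) v → f v ≤ sum f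
  term≤sum f zero    = m≤m+n _ _
  term≤sum f (suc v) = ≤-trans (term≤sum (f ∘ suc) v) (m≤n+m _ _)

  -- All quantities of the proof have this shape: sizes, totals of types, and the degree
  -- `⟨ P , a v ⟩` of `v` into `P`.
  ⟨_,_⟩ : VSet → (Fin n → ℕ) → ℕ
  ⟨ P , f ⟩ = sum (λ v → [ P v ] * f v)

  size : VSet → ℕ
  size P = ⟨ P , const 1 ⟩

  ⟨⟩-≗ : ∀ {P Q} f → P ≗ Q → ⟨ P , f ⟩ ≡ ⟨ Q , f ⟩
  ⟨⟩-≗ f eq = sum-cong-≗ (λ v → cong (λ b → [ b ] * f v) (eq v))

  ⟨⟩-mono : ∀ P {f g} → (∀ v → v ∈ P → f v ≤ g v) → ⟨ P , f ⟩ ≤ ⟨ P , g ⟩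
  ⟨⟩-mono P {f} {g} h = sum-mono λ v → term v
    where
    term : ∀ v → [ P v ] * f v ≤ [ P v ] * g v
    term v with P v in eq
    ... | true  = *-monoʳ-≤ 1 (h v eq)
    ... | false = z≤n

  ⟨⟩-cong : ∀ P {f g} → (∀ v → v ∈ P → f v ≡ g v) → ⟨ P , f ⟩ ≡ ⟨ P , g ⟩
  ⟨⟩-cong P h = ≤-antisym (⟨⟩-mono P λ v p → ≤-reflexive (h v p)) (⟨⟩-mono P λ v p → ≤-reflexive (≡-sym (h v p)))

  ⟨⟩-zero : ∀ P {f} → (∀ v → v ∈ P → f v ≡ 0) → ⟨ P , f ⟩ ≡ 0
  ⟨⟩-zero P h = trans (⟨⟩-cong P h) (trans (sum-cong-≗ λ v → *-zeroʳ [ P v ]) (sum-replicate-zero n))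

  ⟨⟩-split : ∀ {P X Y} f → P ≐ X ⊍ Y → ⟨ P , f ⟩ ≡ ⟨ X , f ⟩ + ⟨ Y , f ⟩
  ⟨⟩-split {P} {X} {Y} f s = trans
    (sum-cong-≗ λ v → trans (cong (_* f v) (indicator s v)) (*-distribʳ-+ (f v) [ X v ] [ Y v ]))
    (∑-distrib-+ (λ v → [ X v ] * f v) (λ v → [ Y v ] * f v))

  ⟨⟩-⊆ : ∀ {X P} f → X ⊆ P → ⟨ X , f ⟩ ≤ ⟨ P , f ⟩
  ⟨⟩-⊆ {X} {P} f X⊆P = sum-mono λ v → *-monoˡ-≤ (f v) (term v)
    where
    term : ∀ v → [ X v ] ≤ [ P v ]
    term v with X v in eq
    ... | true  = ≤-reflexive (cong [_] (≡-sym (X⊆P v eq)))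
    ... | false = z≤n

  ⟨⟩-+ : ∀ P f g → ⟨ P , (λ v → f v + g v) ⟩ ≡ ⟨ P , f ⟩ + ⟨ P , g ⟩
  ⟨⟩-+ P f g = trans
    (sum-cong-≗ λ v → *-distribˡ-+ [ P v ] (f v) (g v))
    (∑-distrib-+ (λ v → [ P v ] * f v) (λ v → [ P v ] * g v))

  ⟨⟩-* : ∀ P k f → ⟨ P , (λ v → k * f v) ⟩ ≡ k * ⟨ P , f ⟩
  ⟨⟩-* P k f = trans
    (sum-cong-≗ λ v → trans (≡-sym (*-assoc [ P v ] k (f v)))
      (trans (cong (_* f v) (*-comm [ P v ] k)) (*-assoc k [ P v ] (f v))))
    (≡-sym (*-distribˡ-sum k (λ v → [ P v ] * f v)))

  ⟨⟩-const : ∀ P k → ⟨ P , const k ⟩ ≡ k * size P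
  ⟨⟩-const P k = trans (⟨⟩-cong P λ _ _ → ≡-sym (*-identityʳ k)) (⟨⟩-* P k (const 1))

  ⟨⟩-∈ : ∀ P f {v} → v ∈ P → f v ≤ ⟨ P , f ⟩
  ⟨⟩-∈ P f {v} p = ≤-trans
    (≤-reflexive (trans (≡-sym (*-identityˡ (f v))) (cong (λ b → [ b ] * f v) (≡-sym p))))
    (term≤sum (λ u → [ P u ] * f u) v)

  ⟨⟩-swap : ∀ X Y (g : Fin n → Fin n → ℕ) →
    ⟨ X , (λ u → ⟨ Y , g u ⟩) ⟩ ≡ ⟨ Y , (λ v → ⟨ X , (λ u → g u v) ⟩) ⟩
  ⟨⟩-swap X Y g = begin
    sum (λ u → [ X u ] * sum (λ v → [ Y v ] * g u v))
      ≡⟨ sum-cong-≗ (λ u → *-distribˡ-sum [ X u ] (λ v → [ Y v ] * g u v)) ⟩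
    sum (λ u → sum (λ v → [ X u ] * ([ Y v ] * g u v)))
      ≡⟨ ∑-comm (λ u v → [ X u ] * ([ Y v ] * g u v)) ⟩
    sum (λ v → sum (λ u → [ X u ] * ([ Y v ] * g u v)))
      ≡⟨ sum-cong-≗ (λ v → sum-cong-≗ λ u → exch [ X u ] [ Y v ] (g u v)) ⟩
    sum (λ v → sum (λ u → [ Y v ] * ([ X u ] * g u v)))
      ≡⟨ sum-cong-≗ (λ v → ≡-sym (*-distribˡ-sum [ Y v ] (λ u → [ X u ] * g u v))) ⟩
    sum (λ v → [ Y v ] * sum (λ u → [ X u ] * g u v)) ∎
    where
    open ≡-Reasoning
    exch : ∀ x y z → x * (y * z) ≡ y * (x * z)
    exch x y z = solve (x ∷ y ∷ z ∷ [])

  ⟨∩｛｝⟩ : ∀ P r f → ⟨ P ∩ ｛ r ｝ , f ⟩ ≡ [ P r ] * f r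
  ⟨∩｛｝⟩ P r f = trans (sum-cong-≗ term) (sum-δ r (λ v → [ P v ] * f v))
    where
    term : ∀ v → [ P v ∧ ｛ r ｝ v ] * f v ≡ [ ｛ r ｝ v ] * ([ P v ] * f v)
    term v with P v | ｛ r ｝ v
    ... | true  | true  = ≡-sym (*-identityˡ _)
    ... | true  | false = refl
    ... | false | true  = refl
    ... | false | false = refl
    sum-δ : ∀ {m} (r : Fin m) (g : Fin m → ℕ) → sum (λ v → [ does (v ≟ r) ] * g v) ≡ g r
    sum-δ {suc m} zero    g = trans (cong (1 * g zero +_) (sum-replicate-zero m)) (trans (+-identityʳ _) (*-identityˡ _))
    sum-δ {suc m} (suc r) g = sum-δ r (g ∘ suc)

  ⟨｛｝⟩ : ∀ r f → ⟨ ｛ r ｝ , f ⟩ ≡ f r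
  ⟨｛｝⟩ r f = trans (⟨∩｛｝⟩ (const true) r f) (*-identityˡ (f r))

  ⟨∅⟩ : ∀ f → ⟨ ∅ , f ⟩ ≡ 0
  ⟨∅⟩ f = sum-replicate-zero n

  -- The two vertices fall into different halves of the split of `P` at `u`.
  pair≤⟨⟩ : ∀ P f {u v} → u ∈ P → v ∈ P → u ≢ v → f u + f v ≤ ⟨ P , f ⟩
  pair≤⟨⟩ P f {u} {v} pu pv u≢v = ≤-trans
    (+-mono-≤ (⟨⟩-∈ (P ∩ ｛ u ｝) f (∈∩ P ｛ u ｝ pu (∈｛｝ u)))
              (⟨⟩-∈ (P ∖ ｛ u ｝) f (∈∖ P ｛ u ｝ pv (∉｛｝ u v (u≢v ∘ ≡-sym)))))
    (≤-reflexive (≡-sym (⟨⟩-split f (split-by ｛ u ｝ P))))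

  -- Edge counts of weighted graphs.

  Weight : Set
  Weight = Fin n → Fin n → ℕ

  _<ꟳ_ : Fin n → Fin n → Bool
  u <ꟳ v = toℕ u <ᵇ toℕ v

  edges : Weight → VSet → ℕ
  edges a P = ⟨ P , (λ u → ⟨ P , (λ v → [ u <ꟳ v ] * a u v) ⟩) ⟩

  edges-≗ : ∀ a {P Q} → P ≗ Q → edges a P ≡ edges a Q
  edges-≗ a {P} {Q} eq = trans (⟨⟩-≗ _ eq) (⟨⟩-cong Q λ u _ → ⟨⟩-≗ _ eq)

  edges-cong : ∀ {a b} P → (∀ u v → u ∈ P → v ∈ P → a u v ≡ b u v) → edges a P ≡ edges b P
  edges-cong P h = ⟨⟩-cong P λ u p → ⟨⟩-cong P λ v q → cong ([ u <ꟳ v ] *_) (h u v p q)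

  -- Entries may exceed 1: contraction produces such entries off the vertex set in play, so
  -- simplicity is demanded only on `V`, in `Admissible`.
  record IsGraph (a : Weight) : Set where
    field
      symm : ∀ u v → a u v ≡ a v u
      diag : ∀ v → a v v ≡ 0

  module GraphLemmas {a : Weight} (isG : IsGraph a) where
    open IsGraph isG

    edges-small : ∀ P → size P ≤ 1 → edges a P ≡ 0
    edges-small P s = ⟨⟩-zero P λ u p → ⟨⟩-zero P λ v q → zero-entry u v p q
      where
      zero-entry : ∀ u v → u ∈ P → v ∈ P → [ u <ꟳ v ] * a u v ≡ 0
      zero-entry u v p q with u ≟ v
      ... | yes refl = trans (cong ([ u <ꟳ v ] *_) (diag u)) (*-zeroʳ [ u <ꟳ v ])
      ... | no u≢v   = contradiction (pair≤⟨⟩ P (const 1) p q u≢v) (≤⇒≯ s)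

    -- Exactly one of the two orders counts a pair of distinct vertices; on the diagonal both sides
    -- vanish.
    orient : ∀ u v → a u v ≡ [ u <ꟳ v ] * a u v + [ v <ꟳ u ] * a v u
    orient u v with <-cmp (toℕ u) (toℕ v)
    ... | tri< u<v _ v≮u
      rewrite Equivalence.to T-≡ (<⇒<ᵇ u<v) | ≮⇒<ᵇ≡false v≮u
      = ≡-sym (trans (+-identityʳ _) (*-identityˡ _))
    ... | tri≈ _ u≡v _ with refl ← toℕ-injective u≡v
      rewrite diag u | *-zeroʳ [ u <ꟳ u ] = refl
    ... | tri> u≮v _ v<u
      rewrite Equivalence.to T-≡ (<⇒<ᵇ v<u) | ≮⇒<ᵇ≡false u≮v
      = trans (symm u v) (≡-sym (*-identityˡ _))

    -- Split by orientation, the double sum becomes two transposed halves, which `⟨⟩-swap`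
    -- identifies.
    handshake : ∀ P → ⟨ P , (λ u → ⟨ P , a u ⟩) ⟩ ≡ edges a P + edges a P
    handshake P = begin
      ⟨ P , (λ u → ⟨ P , a u ⟩) ⟩
        ≡⟨ ⟨⟩-cong P (λ u _ → ⟨⟩-cong P λ v _ → orient u v) ⟩
      ⟨ P , (λ u → ⟨ P , (λ v → o u v + o v u) ⟩) ⟩
        ≡⟨ ⟨⟩-cong P (λ u _ → ⟨⟩-+ P (o u) (λ v → o v u)) ⟩
      ⟨ P , (λ u → ⟨ P , o u ⟩ + ⟨ P , (λ v → o v u) ⟩) ⟩
        ≡⟨ ⟨⟩-+ P (λ u → ⟨ P , o u ⟩) (λ u → ⟨ P , (λ v → o v u) ⟩) ⟩
      edges a P + ⟨ P , (λ u → ⟨ P , (λ v → o v u) ⟩) ⟩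
        ≡⟨ cong (edges a P +_) (⟨⟩-swap P P (λ u v → o v u)) ⟩
      edges a P + edges a P ∎
      where
      open ≡-Reasoning
      o : Fin n → Fin n → ℕ
      o u v = [ u <ꟳ v ] * a u v

    cross-sym : ∀ X Y → ⟨ X , (λ u → ⟨ Y , a u ⟩) ⟩ ≡ ⟨ Y , (λ u → ⟨ X , a u ⟩) ⟩
    cross-sym X Y = trans (⟨⟩-swap X Y a) (⟨⟩-cong Y λ v _ → ⟨⟩-cong X λ u _ → symm u v)

    -- Edges between `X` and `Y` may be oriented either way by the vertex order. Doubling both sides
    -- replaces ordered pairs by symmetric sums; the factor 2 is cancelled at the end.
    edges-split : ∀ {P X Y} → P ≐ X ⊍ Y →
      edges a P ≡ edges a X + edges a Y + ⟨ X , (λ u → ⟨ Y , a u ⟩) ⟩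
    edges-split {P} {X} {Y} s = *-cancelˡ-≡ _ _ 2 (begin
      2 * edges a P                                  ≡⟨ cong (edges a P +_) (+-identityʳ _) ⟩
      edges a P + edges a P                          ≡⟨ ≡-sym (handshake P) ⟩
      g P P                                          ≡⟨ ⟨⟩-split _ s ⟩
      g X P + g Y P                                  ≡⟨ cong₂ _+_ (gˡ X) (gˡ Y) ⟩
      (g X X + g X Y) + (g Y X + g Y Y)              ≡⟨ cong₂ (λ p q → (p + g X Y) + (g Y X + q)) (handshake X) (handshake Y) ⟩
      (eX + eX + g X Y) + (g Y X + (eY + eY))        ≡⟨ cong (λ q → (eX + eX + g X Y) + (q + (eY + eY))) (cross-sym Y X) ⟩
      (eX + eX + g X Y) + (g X Y + (eY + eY))        ≡⟨ rearrange eX eY (g X Y) ⟩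
      2 * (eX + eY + g X Y) ∎)
      where
      open ≡-Reasoning
      g : VSet → VSet → ℕ
      g X Y = ⟨ X , (λ u → ⟨ Y , a u ⟩) ⟩
      eX eY : ℕ
      eX = edges a X
      eY = edges a Y
      gˡ : ∀ Z → g Z P ≡ g Z X + g Z Y
      gˡ Z = trans (⟨⟩-cong Z λ u _ → ⟨⟩-split (a u) s) (⟨⟩-+ Z (λ u → ⟨ X , a u ⟩) (λ u → ⟨ Y , a u ⟩))
      rearrange : ∀ x y c → (x + x + c) + (c + (y + y)) ≡ 2 * (x + y + c)
      rearrange x y c = solve (x ∷ y ∷ c ∷ [])

-- Forests, colourings and the potential.

module Colour (n D : ℕ) where

  open VertexSets n

  any∈? : (P : VSet) → (∃ λ x → x ∈ P) ⊎ (∀ v → P v ≡ false)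
  any∈? P with any? (λ x → P x Bool.≟ true)
  ... | yes p = inj₁ p
  ... | no ¬p = inj₂ λ v → ¬-not (λ p → ¬p (v , p))

  ∉∅ : ∀ {P : VSet} {A : Set} → (∀ v → P v ≡ false) → ∀ {v} → v ∈ P → A
  ∉∅ e {v} p with () ← trans (≡-sym p) (e v)

  -- Acyclicity as an edge count, so that gluing forests is addition.
  Forest : Weight → VSet → Set
  Forest a M = ∀ S → S ⊆ M → ∀ x → x ∈ S → edges a S < size S

  Forest-⊆ : ∀ {a X Y} → X ⊆ Y → Forest a Y → Forest a X
  Forest-⊆ X⊆Y f S S⊆X = f S (λ v p → X⊆Y v (S⊆X v p))

  module _ {a : Weight} (isG : IsGraph a) where
    open IsGraph isG
    open GraphLemmas isG

    edges-∅ : ∀ {P} → (∀ v → P v ≡ false) → edges a P ≡ 0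
    edges-∅ {P} e = ⟨⟩-zero P λ v p → ∉∅ {P} e p

    size-∩｛｝ : ∀ P r → size (P ∩ ｛ r ｝) ≡ [ P r ]
    size-∩｛｝ P r = trans (⟨∩｛｝⟩ P r (const 1)) (*-identityʳ [ P r ])

    [-]≤1 : ∀ b → [ b ] ≤ 1
    [-]≤1 true  = ≤-refl
    [-]≤1 false = z≤n

    size-vertex : ∀ P r → size P ≡ [ P r ] + size (P ∖ ｛ r ｝)
    size-vertex P r = trans (⟨⟩-split (const 1) (split-by ｛ r ｝ P))
      (cong (_+ size (P ∖ ｛ r ｝)) (size-∩｛｝ P r))

    edges-vertex : ∀ P r → edges a P ≡ edges a (P ∖ ｛ r ｝) + [ P r ] * ⟨ P ∖ ｛ r ｝ , a r ⟩
    edges-vertex P r = trans (edges-split (split-by ｛ r ｝ P)) (cong₂ _+_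
      (cong (_+ edges a (P ∖ ｛ r ｝)) (edges-small (P ∩ ｛ r ｝) (≤-trans (≤-reflexive (size-∩｛｝ P r)) ([-]≤1 (P r)))))
      (⟨∩｛｝⟩ P r (λ u → ⟨ P ∖ ｛ r ｝ , a u ⟩)))

    -- Removing `v` from `S` loses at most one edge, and none if `v` is not in `S`. If nothing
    -- remains, the hypothesis on `X` is silent, but `S` has no edges.
    forest-add-leaf : ∀ {X Y} v → Y ∖ ｛ v ｝ ⊆ X → ⟨ X , a v ⟩ ≤ 1 → Forest a X → Forest a Y
    forest-add-leaf {X} {Y} v Y⊆X leaf f S S⊆Y x x∈S with any∈? (S ∖ ｛ v ｝)
    ... | inj₁ (y , y∈S′) = begin-strict
      edges a S                              ≡⟨ edges-vertex S v ⟩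
      edges a S′ + [ S v ] * ⟨ S′ , a v ⟩    ≤⟨ +-monoʳ-≤ (edges a S′) (*-monoʳ-≤ [ S v ] (≤-trans (⟨⟩-⊆ (a v) S′⊆X) leaf)) ⟩
      edges a S′ + [ S v ] * 1               ≡⟨ cong (edges a S′ +_) (*-identityʳ [ S v ]) ⟩
      edges a S′ + [ S v ]                   <⟨ +-monoˡ-< [ S v ] (f S′ S′⊆X y y∈S′) ⟩
      size S′ + [ S v ]                      ≡⟨ +-comm (size S′) [ S v ] ⟩
      [ S v ] + size S′                      ≡⟨ size-vertex S v ⟨
      size S ∎
      where
      open ≤-Reasoning
      S′ : VSet
      S′ = S ∖ ｛ v ｝
      S′⊆X : S′ ⊆ X
      S′⊆X u p = Y⊆X u (∈∖ Y ｛ v ｝ (S⊆Y u (∖⊆ S ｛ v ｝ u p)) (∖∉ S ｛ v ｝ u p))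
    ... | inj₂ empty = begin-strict
      edges a S                              ≡⟨ edges-vertex S v ⟩
      edges a S′ + [ S v ] * ⟨ S′ , a v ⟩    ≡⟨ cong₂ (λ p q → p + [ S v ] * q) (edges-∅ {S′} empty) (⟨⟩-zero S′ λ u p → ∉∅ {S′} empty p) ⟩
      [ S v ] * 0                            ≡⟨ *-zeroʳ [ S v ] ⟩
      0                                      <⟨ ⟨⟩-∈ S (const 1) x∈S ⟩
      size S ∎
      where
      open ≤-Reasoning
      S′ : VSet
      S′ = S ∖ ｛ v ｝

  -- c is the indicator of M; the type j v counts M-neighbours of v outside the graph.
  record Colouring (a : Weight) (j : Fin n → ℕ) (V c : VSet) : Set where
    field
      forestM : Forest a (V ∩ c)
      forestF : Forest a (V ∖ c)
      degM    : ∀ v → v ∈ V ∩ c → j v + ⟨ V ∩ c , a v ⟩ ≤ D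

  -- `ĵ` are the types under which the graph without `v` was coloured: equal to `j`, or raised at
  -- the neighbours of `v`.
  module _ {a : Weight} (isG : IsGraph a) {j ĵ : Fin n → ℕ} (j≤ĵ : ∀ u → j u ≤ ĵ u) {V c : VSet} {v : Fin n} (v∈V : v ∈ V) (col : Colouring a ĵ (V ∖ ｛ v ｝) c) where
    open IsGraph isG
    open Colouring col

    -- The value of `c` at the deleted vertex is arbitrary, so `v` is taken out of M explicitly.
    extendF : ⟨ V ∖ ｛ v ｝ ∖ c , a v ⟩ ≤ 1 → Colouring a j V (c ∖ ｛ v ｝)
    extendF leaf = record
      { forestM = Forest-⊆ M⊆ forestM
      ; forestF = forest-add-leaf isG v F⊆ leaf forestF
      ; degM    = λ u p → ≤-trans (+-mono-≤ (j≤ĵ u) (⟨⟩-⊆ (a u) M⊆)) (degM u (M⊆ u p))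
      }
      where
      M⊆ : V ∩ (c ∖ ｛ v ｝) ⊆ (V ∖ ｛ v ｝) ∩ c
      M⊆ u p with V u | c u | ｛ v ｝ u
      ... | true | true | false = refl
      F⊆ : V ∖ (c ∖ ｛ v ｝) ∖ ｛ v ｝ ⊆ V ∖ ｛ v ｝ ∖ c
      F⊆ u p with V u | c u | ｛ v ｝ u
      F⊆ u p  | true | false | false = refl
      F⊆ u () | true | false | true
      F⊆ u () | true | true  | true

    -- The last hypothesis says that each M-neighbour of `v` was coloured with enough spare type to
    -- absorb its new edge to `v`.
    extendM : let X = (V ∖ ｛ v ｝) ∩ c in
      ⟨ X , a v ⟩ ≤ 1 → j v + ⟨ X , a v ⟩ ≤ D → (∀ u → u ∈ X → j u + a v u ≤ ĵ u) →
      Colouring a j V (c ∪ ｛ v ｝)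
    extendM leaf room spare = record
      { forestM = forest-add-leaf isG v M⊆ leaf forestM
      ; forestF = Forest-⊆ F⊆ forestF
      ; degM    = deg
      }
      where
      X Y : VSet
      X = (V ∖ ｛ v ｝) ∩ c
      Y = V ∩ (c ∪ ｛ v ｝)
      M⊆ : Y ∖ ｛ v ｝ ⊆ X
      M⊆ u p with V u | c u | ｛ v ｝ u
      M⊆ u p  | true | true  | false = refl
      M⊆ u () | true | true  | true
      M⊆ u () | true | false | true
      F⊆ : V ∖ (c ∪ ｛ v ｝) ⊆ V ∖ ｛ v ｝ ∖ c
      F⊆ u p with V u | c u | ｛ v ｝ u
      ... | true | false | false = refl
      degY : ∀ u → ⟨ Y , a u ⟩ ≤ a v u + ⟨ X , a u ⟩
      degY u = begin
        ⟨ Y , a u ⟩                                    ≡⟨ ⟨⟩-split (a u) (split-by ｛ v ｝ Y) ⟩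
        ⟨ Y ∩ ｛ v ｝ , a u ⟩ + ⟨ Y ∖ ｛ v ｝ , a u ⟩    ≤⟨ +-mono-≤ (⟨⟩-⊆ (a u) (∩⊆ʳ Y ｛ v ｝)) (⟨⟩-⊆ (a u) M⊆) ⟩
        ⟨ ｛ v ｝ , a u ⟩ + ⟨ X , a u ⟩                 ≡⟨ cong (_+ ⟨ X , a u ⟩) (trans (⟨｛｝⟩ v (a u)) (symm u v)) ⟩
        a v u + ⟨ X , a u ⟩ ∎
        where open ≤-Reasoning
      deg : ∀ u → u ∈ Y → j u + ⟨ Y , a u ⟩ ≤ D
      deg u u∈Y = by-cases (u ≟ v)
        where
        u∈X : u ≢ v → u ∈ X
        u∈X u≢v = M⊆ u (∈∖ Y ｛ v ｝ u∈Y (∉｛｝ v u u≢v))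
        by-cases : Dec (u ≡ v) → j u + ⟨ Y , a u ⟩ ≤ D
        by-cases (yes refl) = ≤-trans (+-monoʳ-≤ (j v) (≤-trans (degY v) (≤-reflexive (cong (_+ ⟨ X , a v ⟩) (diag v))))) room
        by-cases (no u≢v) = begin
          j u + ⟨ Y , a u ⟩             ≤⟨ +-monoʳ-≤ (j u) (degY u) ⟩
          j u + (a v u + ⟨ X , a u ⟩)   ≡⟨ +-assoc (j u) (a v u) _ ⟨
          j u + a v u + ⟨ X , a u ⟩     ≤⟨ +-monoˡ-≤ _ (spare u (u∈X u≢v)) ⟩
          ĵ u + ⟨ X , a u ⟩             ≤⟨ degM u (u∈X u≢v) ⟩
          D ∎
          where open ≤-Reasoning

  -- W P − K a j P is the potential ρ(P).
  K : Weight → (Fin n → ℕ) → VSet → ℕ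
  K a j P = 3 * suc D * edges a P + 3 * ⟨ P , j ⟩

  W : VSet → ℕ
  W P = (6 * D + 5) * size P

  K-≗ : ∀ a j {P Q} → P ≗ Q → K a j P ≡ K a j Q
  K-≗ a j eq = cong₂ (λ e w → 3 * suc D * e + 3 * w) (edges-≗ a eq) (⟨⟩-≗ j eq)

  W-≗ : ∀ {P Q} → P ≗ Q → W P ≡ W Q
  W-≗ eq = cong ((6 * D + 5) *_) (⟨⟩-≗ (const 1) eq)

  W-split : ∀ {P X Y} → P ≐ X ⊍ Y → W P ≡ W X + W Y
  W-split s = trans (cong ((6 * D + 5) *_) (⟨⟩-split (const 1) s)) (*-distribˡ-+ (6 * D + 5) _ _)

  -- The potential is additive up to the edges between the parts. These are summed from the side of
  -- `Y`, as the degrees into `X`.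
  K-split : ∀ {a} (isG : IsGraph a) j {P X Y} → P ≐ X ⊍ Y →
    K a j P ≡ K a j X + K a j Y + 3 * suc D * ⟨ Y , (λ u → ⟨ X , a u ⟩) ⟩
  K-split {a} isG j {P} {X} {Y} s = trans
    (cong₂ (λ e w → 3 * suc D * e + 3 * w)
      (trans (edges-split s) (cong (edges a X + edges a Y +_) (cross-sym X Y)))
      (⟨⟩-split j s))
    (rearrange D (edges a X) (edges a Y) _ ⟨ X , j ⟩ ⟨ Y , j ⟩)
    where
    open GraphLemmas isG
    rearrange : ∀ D x y c p q → 3 * suc D * (x + y + c) + 3 * (p + q) ≡ 3 * suc D * x + 3 * p + (3 * suc D * y + 3 * q) + 3 * suc D * c
    rearrange D x y c p q = solve (D ∷ x ∷ y ∷ c ∷ p ∷ q ∷ [])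

  -- The condition ρ ≥ -2, written without subtraction.
  Sparseⱼ : Weight → (Fin n → ℕ) → VSet → Set
  Sparseⱼ a j V = ∀ P → P ⊆ V → K a j P ≤ W P + 2

  record Admissible (a : Weight) (j : Fin n → ℕ) (V : VSet) : Set where
    field
      isGraph : IsGraph a
      simple  : ∀ u v → u ∈ V → v ∈ V → a u v ≤ 1
      j≤1+D   : ∀ v → j v ≤ suc D
      sparse  : Sparseⱼ a j V

  -- A vertex of M has type ≤ D, so the cap does not affect it (uncap).
  raise : (Fin n → ℕ) → (Fin n → ℕ) → Fin n → ℕ
  raise j τ v = (j v + τ v) ⊓ suc D

  uncap : ∀ x → x ⊓ suc D ≤ D → x ≤ x ⊓ suc D
  uncap x h with ≤-total x (suc D)
  ... | inj₁ x≤ = ≤-reflexive (≡-sym (m≤n⇒m⊓n≡m x≤))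
  ... | inj₂ x≥ = contradiction (subst (_≤ D) (m≥n⇒m⊓n≡n x≥) h) (<⇒≱ ≤-refl)

  -- Raising types by a total of `k` lowers ρ by at most 3k. Sets with at most one vertex need no
  -- slack: they span no edge, and the cap `suc D` keeps their ρ nonnegative.
  raise-sparse : ∀ {a} (isG : IsGraph a) {j V} τ k → ⟨ V , τ ⟩ ≤ k →
    (∀ P → P ⊆ V → 2 ≤ size P → K a j P + 3 * k ≤ W P + 2) → Sparseⱼ a (raise j τ) V
  raise-sparse {a} isG {j} {V} τ k τ≤k gap P P⊆V with 2 ≤? size P
  ... | yes two = begin
    3 * suc D * edges a P + 3 * ⟨ P , raise j τ ⟩
      ≤⟨ +-monoʳ-≤ (3 * suc D * edges a P) (*-monoʳ-≤ 3 (begin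
           ⟨ P , raise j τ ⟩                ≤⟨ ⟨⟩-mono P (λ v _ → m⊓n≤m (j v + τ v) (suc D)) ⟩
           ⟨ P , (λ v → j v + τ v) ⟩        ≡⟨ ⟨⟩-+ P j τ ⟩
           ⟨ P , j ⟩ + ⟨ P , τ ⟩            ≤⟨ +-monoʳ-≤ ⟨ P , j ⟩ (≤-trans (⟨⟩-⊆ τ P⊆V) τ≤k) ⟩
           ⟨ P , j ⟩ + k                    ∎)) ⟩
    3 * suc D * edges a P + 3 * (⟨ P , j ⟩ + k)  ≡⟨ rearrange (3 * suc D * edges a P) ⟨ P , j ⟩ k ⟩
    K a j P + 3 * k                              ≤⟨ gap P P⊆V two ⟩
    W P + 2 ∎
    where
    open ≤-Reasoning
    rearrange : ∀ e p k → e + 3 * (p + k) ≡ e + 3 * p + 3 * k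
    rearrange e p k = solve (e ∷ p ∷ k ∷ [])
  ... | no ¬two = begin
    3 * suc D * edges a P + 3 * ⟨ P , raise j τ ⟩
      ≤⟨ +-mono-≤
           (≤-reflexive (cong (3 * suc D *_) (GraphLemmas.edges-small isG P (≤-pred (≰⇒> ¬two)))))
           (*-monoʳ-≤ 3 (≤-trans (⟨⟩-mono P (λ v _ → m⊓n≤n (j v + τ v) (suc D))) (≤-reflexive (⟨⟩-const P (suc D))))) ⟩
    3 * suc D * 0 + 3 * (suc D * size P)   ≤⟨ small D (size P) ⟩
    W P + 2 ∎
    where
    open ≤-Reasoning
    small : ∀ D s → 3 * suc D * 0 + 3 * (suc D * s) ≤ (6 * D + 5) * s + 2
    small D s = lin (3 * D * s + 2 * s + 2) (≤-refl {0}) (solve (D ∷ s ∷ []))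

-- Gluing a colouring of a subset to a colouring of the contracted graph.

module Gluing (n D : ℕ) where

  open VertexSets n
  open Colour n D

  -- Z has at most one vertex: an outside neighbour of A whose type is raised by 1 only instead of
  -- D + 1, because A was coloured with one unit to spare at its neighbour.
  module Glue
    {a : Weight} {j : Fin n → ℕ} {V : VSet} (adm : Admissible a j V)
    {A : VSet} (A⊆V : A ⊆ V) {r : Fin n} (r∈A : r ∈ A)
    (one-nbr : ∀ v → v ∈ V ∖ A → ⟨ A , a v ⟩ ≤ 1)
    (low : W A ≤ K a j A + 3 * D)
    {Z : VSet} (size-Z : size Z ≤ 1)
    (Z-nbr : ∀ v → v ∈ Z → v ∈ V ∖ A → 1 ≤ ⟨ A , a v ⟩)
    (avoid-Z : ∀ Q → Q ⊆ V ∖ A → ⟨ Q , (λ v → [ Z v ]) ⟩ ≡ 0 →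
      K a j Q + 3 * suc D * ⟨ Q , (λ v → ⟨ A , a v ⟩) ⟩ ≤ W Q + 2)
    {cA : VSet} (colA : Colouring a (raise j (λ m → ⟨ Z , a m ⟩)) A cA)
    where

    open Admissible adm
    open IsGraph isGraph
    open GraphLemmas isGraph

    U FA MA V′ : VSet
    U  = V ∖ A
    FA = A ∖ cA
    MA = A ∩ cA
    V′ = U ∪ ｛ r ｝

    -- `κ` is the type increase per M-neighbour in `A`: `suc D` forces a vertex into F, whereas 1
    -- merely counts the neighbour.
    dA dF dM κ : Fin n → ℕ
    dA v = ⟨ A , a v ⟩
    dF v = ⟨ FA , a v ⟩
    dM v = ⟨ MA , a v ⟩
    κ v = if Z v then 1 else suc D

    -- FA is contracted to the vertex r of A.
    a′ : Weight
    a′ u v = if ｛ r ｝ u then (if ｛ r ｝ v then 0 else dF v) else (if ｛ r ｝ v then dF u else a u v)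

    j′ : Fin n → ℕ
    j′ v = if ｛ r ｝ v then suc D else raise j (λ v → dM v * κ v) v

    dA-split : ∀ v → dA v ≡ dM v + dF v
    dA-split v = ⟨⟩-split (a v) (split-by cA A)

    dM≤dA : ∀ v → dM v ≤ dA v
    dM≤dA v = ⟨⟩-⊆ (a v) (∩⊆ˡ A cA)

    dF≤dA : ∀ v → dF v ≤ dA v
    dF≤dA v = ⟨⟩-⊆ (a v) (∖⊆ A cA)

    U≢r : ∀ {v} → v ∈ U → ｛ r ｝ v ≡ false
    U≢r {v} v∈U = ∉｛｝ r v (∉⇒≢ A r∈A (∖∉ V A v v∈U) ∘ ≡-sym)

    V′⇒U : ∀ v → v ∈ V′ → ｛ r ｝ v ≡ false → v ∈ U
    V′⇒U v p q with U v
    ... | true = refl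
    ... | false with () ← trans (≡-sym p) q

    U⊆V′ : U ⊆ V′
    U⊆V′ = ∪⊇ˡ U ｛ r ｝

    r∈V′ : r ∈ V′
    r∈V′ = trans (cong (U r ∨_) (∈｛｝ r)) (∨-zeroʳ (U r))

    a′-off : ∀ {u v} → ｛ r ｝ u ≡ false → ｛ r ｝ v ≡ false → a′ u v ≡ a u v
    a′-off p q rewrite p | q = refl

    a′-r : ∀ {v} → ｛ r ｝ v ≡ false → a′ r v ≡ dF v
    a′-r q rewrite ∈｛｝ r | q = refl

    isGraph′ : IsGraph a′
    isGraph′ = record { symm = symm′ ; diag = diag′ }
      where
      symm′ : ∀ u v → a′ u v ≡ a′ v u
      symm′ u v with ｛ r ｝ u | ｛ r ｝ v
      ... | true  | true  = refl
      ... | true  | false = refl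
      ... | false | true  = refl
      ... | false | false = symm u v
      diag′ : ∀ v → a′ v v ≡ 0
      diag′ v with ｛ r ｝ v
      ... | true  = refl
      ... | false = diag v

    simple′ : ∀ u v → u ∈ V′ → v ∈ V′ → a′ u v ≤ 1
    simple′ u v u∈ v∈ with ｛ r ｝ u in eqᵤ | ｛ r ｝ v in eqᵥ
    ... | true  | true  = z≤n
    ... | true  | false = ≤-trans (dF≤dA v) (one-nbr v (V′⇒U v (trans (cong (U v ∨_) eqᵥ) v∈) eqᵥ))
    ... | false | true  = ≤-trans (dF≤dA u) (one-nbr u (V′⇒U u (trans (cong (U u ∨_) eqᵤ) u∈) eqᵤ))
    ... | false | false = simple u v
      (∖⊆ V A u (V′⇒U u (trans (cong (U u ∨_) eqᵤ) u∈) eqᵤ))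
      (∖⊆ V A v (V′⇒U v (trans (cong (U v ∨_) eqᵥ) v∈) eqᵥ))

    j′≤1+D : ∀ v → j′ v ≤ suc D
    j′≤1+D v with ｛ r ｝ v
    ... | true  = ≤-refl
    ... | false = m⊓n≤n _ (suc D)

    -- A vertex of `Z` has a neighbour in `A` and pays 1 instead of `suc D` for it, which saves `D`.
    charge-Z : ∀ v → v ∈ U → dM v * κ v + D * [ Z v ] ≤ suc D * dA v
    charge-Z v v∈U with Z v in eq
    ... | true  = begin
      dM v * 1 + D * 1   ≤⟨ +-mono-≤ (*-monoˡ-≤ 1 (dM≤dA v)) (*-monoʳ-≤ D (Z-nbr v eq v∈U)) ⟩
      dA v * 1 + D * dA v ≡⟨ cong (_+ D * dA v) (*-identityʳ (dA v)) ⟩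
      suc D * dA v ∎
      where open ≤-Reasoning
    ... | false = begin
      dM v * suc D + D * 0  ≡⟨ cong (dM v * suc D +_) (*-zeroʳ D) ⟩
      dM v * suc D + 0      ≡⟨ +-identityʳ _ ⟩
      dM v * suc D          ≡⟨ *-comm (dM v) (suc D) ⟩
      suc D * dM v          ≤⟨ *-monoʳ-≤ (suc D) (dM≤dA v) ⟩
      suc D * dA v ∎
      where open ≤-Reasoning

    κ≤1+D : ∀ v → κ v ≤ suc D
    κ≤1+D v with Z v
    ... | true  = s≤s z≤n
    ... | false = ≤-refl

    1≤κ : ∀ v → 1 ≤ κ v
    1≤κ v with Z v
    ... | true  = ≤-refl
    ... | false = s≤s z≤n

    -- Each edge from `v` to `A` is paid for once: as a type increase if it ends in `MA`, as an edge
    -- to `r` if it ends in `FA`.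
    charge-F : ∀ v → dM v * κ v + suc D * dF v ≤ suc D * dA v
    charge-F v = begin
      dM v * κ v + suc D * dF v     ≤⟨ +-monoˡ-≤ _ (*-monoʳ-≤ (dM v) (κ≤1+D v)) ⟩
      dM v * suc D + suc D * dF v   ≡⟨ cong (_+ suc D * dF v) (*-comm (dM v) (suc D)) ⟩
      suc D * dM v + suc D * dF v   ≡⟨ *-distribˡ-+ (suc D) (dM v) (dF v) ⟨
      suc D * (dM v + dF v)         ≡⟨ cong (suc D *_) (dA-split v) ⟨
      suc D * dA v ∎
      where open ≤-Reasoning

    edges-off : ∀ Q → Q ⊆ U → edges a′ Q ≡ edges a Q
    edges-off Q Q⊆U = edges-cong Q λ u v p q → a′-off (U≢r (Q⊆U u p)) (U≢r (Q⊆U v q))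

    -- The sparsity of `A ∪ Q` in the old graph gives the bound for `Q` and its edges to `A` up to
    -- an excess of 3D. The excess is absorbed by `r` if `r` lies in `P`, and by the saving at `Z`
    -- if `Q` meets `Z`; otherwise `avoid-Z` gives the bound without excess.
    sparse′ : Sparseⱼ a′ j′ V′
    sparse′ P P⊆V′ = bound
      where
      open ≤-Reasoning
      Q : VSet
      Q = P ∖ ｛ r ｝

      Q⊆U : Q ⊆ U
      Q⊆U v p = V′⇒U v (P⊆V′ v (∖⊆ P ｛ r ｝ v p)) (∖∉ P ｛ r ｝ v p)

      x y f z : ℕ
      x = ⟨ Q , (λ v → dM v * κ v) ⟩
      y = ⟨ Q , dA ⟩
      f = ⟨ Q , dF ⟩
      z = ⟨ Q , (λ v → [ Z v ]) ⟩

      x+Dz≤y : x + D * z ≤ suc D * y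
      x+Dz≤y = begin
        x + D * z                                        ≡⟨ cong (x +_) (⟨⟩-* Q D (λ v → [ Z v ])) ⟨
        x + ⟨ Q , (λ v → D * [ Z v ]) ⟩                  ≡⟨ ⟨⟩-+ Q _ _ ⟨
        ⟨ Q , (λ v → dM v * κ v + D * [ Z v ]) ⟩         ≤⟨ ⟨⟩-mono Q (λ v p → charge-Z v (Q⊆U v p)) ⟩
        ⟨ Q , (λ v → suc D * dA v) ⟩                     ≡⟨ ⟨⟩-* Q (suc D) dA ⟩
        suc D * y ∎

      x+f≤y : x + suc D * f ≤ suc D * y
      x+f≤y = begin
        x + suc D * f                                    ≡⟨ cong (x +_) (⟨⟩-* Q (suc D) dF) ⟨
        x + ⟨ Q , (λ v → suc D * dF v) ⟩                 ≡⟨ ⟨⟩-+ Q _ _ ⟨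
        ⟨ Q , (λ v → dM v * κ v + suc D * dF v) ⟩        ≤⟨ ⟨⟩-mono Q (λ v _ → charge-F v) ⟩
        ⟨ Q , (λ v → suc D * dA v) ⟩                     ≡⟨ ⟨⟩-* Q (suc D) dA ⟩
        suc D * y ∎

      edges′ : edges a′ P ≡ edges a Q + [ P r ] * f
      edges′ = trans (edges-vertex isGraph′ P r) (cong₂ (λ e w → e + [ P r ] * w)
        (edges-off Q Q⊆U)
        (⟨⟩-cong Q λ v p → a′-r (∖∉ P ｛ r ｝ v p)))

      types′ : ⟨ P , j′ ⟩ ≤ [ P r ] * suc D + (⟨ Q , j ⟩ + x)
      types′ = begin
        ⟨ P , j′ ⟩                                ≡⟨ ⟨⟩-split j′ (split-by ｛ r ｝ P) ⟩
        ⟨ P ∩ ｛ r ｝ , j′ ⟩ + ⟨ Q , j′ ⟩          ≡⟨ cong (_+ ⟨ Q , j′ ⟩) (⟨∩｛｝⟩ P r j′) ⟩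
        [ P r ] * j′ r + ⟨ Q , j′ ⟩               ≤⟨ +-mono-≤ (*-monoʳ-≤ [ P r ] (j′≤1+D r)) (⟨⟩-mono Q j′≤) ⟩
        [ P r ] * suc D + ⟨ Q , (λ v → j v + dM v * κ v) ⟩ ≡⟨ cong ([ P r ] * suc D +_) (⟨⟩-+ Q j _) ⟩
        [ P r ] * suc D + (⟨ Q , j ⟩ + x) ∎
        where
        j′≤ : ∀ v → v ∈ Q → j′ v ≤ j v + dM v * κ v
        j′≤ v p rewrite ∖∉ P ｛ r ｝ v p = m⊓n≤m _ (suc D)

      K′≤ : K a′ j′ P ≤ 3 * suc D * (edges a Q + [ P r ] * f) + 3 * ([ P r ] * suc D + (⟨ Q , j ⟩ + x))
      K′≤ = +-mono-≤ (≤-reflexive (cong (3 * suc D *_) edges′)) (*-monoʳ-≤ 3 types′)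

      W′ : W P ≡ (6 * D + 5) * ([ P r ] + size Q)
      W′ = cong ((6 * D + 5) *_) (size-vertex isGraph P r)

      A∪Q-sparse : K a j A + K a j Q + 3 * suc D * y ≤ W A + W Q + 2
      A∪Q-sparse = begin
        K a j A + K a j Q + 3 * suc D * y   ≡⟨ K-split isGraph j s ⟨
        K a j (A ∪ Q)                       ≤⟨ sparse (A ∪ Q) (∪⊆ A⊆V λ v p → ∖⊆ V A v (Q⊆U v p)) ⟩
        W (A ∪ Q) + 2                       ≡⟨ cong (_+ 2) (W-split s) ⟩
        W A + W Q + 2 ∎
        where
        s : A ∪ Q ≐ A ⊍ Q
        s = split-∪ A Q λ v p → ∖∉ V A v (Q⊆U v p)

      KQ-bound : K a j Q + 3 * suc D * y ≤ W Q + (2 + 3 * D)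
      KQ-bound = arith (W A) (K a j A) (K a j Q) (3 * suc D * y) (W Q) D A∪Q-sparse low
        where
        arith : ∀ wA kA kQ t wQ D → kA + kQ + t ≤ wA + wQ + 2 → wA ≤ kA + 3 * D → kQ + t ≤ wQ + (2 + 3 * D)
        arith wA kA kQ t wQ D h₁ h₂ = lin 0 (+-mono-≤ h₁ h₂) (solve (wA ∷ kA ∷ kQ ∷ t ∷ wQ ∷ D ∷ []))

      -- The vertex `r` of type `suc D` contributes 6D + 5 - 3(D + 1) = 3D + 2.
      with-r : ∀ D e f p x y w → x + suc D * f ≤ suc D * y →
        3 * suc D * e + 3 * p + 3 * suc D * y ≤ (6 * D + 5) * w + (2 + 3 * D) →
        3 * suc D * (e + 1 * f) + 3 * (1 * suc D + (p + x)) ≤ (6 * D + 5) * (1 + w) + 2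
      with-r D e f p x y w h₁ h₂ = lin 2 (+-mono-≤ (scale 3 h₁) h₂) (solve (D ∷ e ∷ f ∷ p ∷ x ∷ y ∷ w ∷ []))

      -- With at least one vertex of `Z` in `Q`, the saving is D times the factor 3 of types,
      -- exactly the excess.
      without-r : ∀ D e f p x y z w → x + D * suc z ≤ suc D * y →
        3 * suc D * e + 3 * p + 3 * suc D * y ≤ (6 * D + 5) * w + (2 + 3 * D) →
        3 * suc D * (e + 0 * f) + 3 * (0 * suc D + (p + x)) ≤ (6 * D + 5) * (0 + w) + 2
      without-r D e f p x y z w h₁ h₂ = lin (3 * D * z) (+-mono-≤ (scale 3 h₁) h₂) (solve (D ∷ e ∷ f ∷ p ∷ x ∷ y ∷ z ∷ w ∷ []))

      without-r-Z : ∀ D e f p x y w → x + D * 0 ≤ suc D * y →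
        3 * suc D * e + 3 * p + 3 * suc D * y ≤ (6 * D + 5) * w + 2 →
        3 * suc D * (e + 0 * f) + 3 * (0 * suc D + (p + x)) ≤ (6 * D + 5) * (0 + w) + 2
      without-r-Z D e f p x y w h₁ h₂ = lin 0 (+-mono-≤ (scale 3 h₁) h₂) (solve (D ∷ e ∷ f ∷ p ∷ x ∷ y ∷ w ∷ []))

      main : ∀ b z′ → z′ ≡ z →
        3 * suc D * (edges a Q + [ b ] * f) + 3 * ([ b ] * suc D + (⟨ Q , j ⟩ + x)) ≤ (6 * D + 5) * ([ b ] + size Q) + 2
      main true  _        _  = with-r D (edges a Q) f ⟨ Q , j ⟩ x y (size Q) x+f≤y KQ-bound
      main false (suc z′) eq = without-r D (edges a Q) f ⟨ Q , j ⟩ x y z′ (size Q)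
        (subst (λ t → x + D * t ≤ suc D * y) (≡-sym eq) x+Dz≤y) KQ-bound
      main false zero     eq = without-r-Z D (edges a Q) f ⟨ Q , j ⟩ x y (size Q)
        (subst (λ t → x + D * t ≤ suc D * y) (≡-sym eq) x+Dz≤y) (avoid-Z Q Q⊆U (≡-sym eq))

      bound : K a′ j′ P ≤ W P + 2
      bound = ≤-trans K′≤ (≤-trans (main (P r) z refl) (≤-reflexive (cong (_+ 2) (≡-sym W′))))

    admissible′ : Admissible a′ j′ V′
    admissible′ = record { isGraph = isGraph′ ; simple = simple′ ; j≤1+D = j′≤1+D ; sparse = sparse′ }

    -- `r` lies in `A`, so its colour under `c′` is discarded; in the contracted graph it stands for
    -- the whole of `FA`.
    glue : ∀ {c′} → Colouring a′ j′ V′ c′ → Colouring a j V (λ v → if A v then cA v else c′ v)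
    glue {c′} col′ = record { forestM = forestM ; forestF = forestF ; degM = degM }
      where
      module CA = Colouring colA
      module C′ = Colouring col′
      open ≤-Reasoning

      c : VSet
      c v = if A v then cA v else c′ v

      MU FU : VSet
      MU = U ∩ c′
      FU = U ∖ c′

      c≡cA : ∀ v → v ∈ A → c v ≡ cA v
      c≡cA v p = cong (if_then cA v else c′ v) p

      c≡c′ : ∀ v → A v ≡ false → c v ≡ c′ v
      c≡c′ v p = cong (if_then cA v else c′ v) p

      M⊆MA : (V ∩ c) ∩ A ⊆ MA
      M⊆MA v p = ∈∩ A cA v∈A (trans (≡-sym (c≡cA v v∈A)) (∩⊆ʳ V c v (∩⊆ˡ (V ∩ c) A v p)))
        where
        v∈A : v ∈ A
        v∈A = ∩⊆ʳ (V ∩ c) A v p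

      F⊆FA : (V ∖ c) ∩ A ⊆ FA
      F⊆FA v p = ∈∖ A cA v∈A (trans (≡-sym (c≡cA v v∈A)) (∖∉ V c v (∩⊆ˡ (V ∖ c) A v p)))
        where
        v∈A : v ∈ A
        v∈A = ∩⊆ʳ (V ∖ c) A v p

      M⊆MU : V ∩ c ∖ A ⊆ MU
      M⊆MU v p = ∈∩ U c′ (∈∖ V A (∩⊆ˡ V c v v∈M) v∉A) (trans (≡-sym (c≡c′ v v∉A)) (∩⊆ʳ V c v v∈M))
        where
        v∈M : v ∈ V ∩ c
        v∈M = ∖⊆ (V ∩ c) A v p
        v∉A : A v ≡ false
        v∉A = ∖∉ (V ∩ c) A v p

      F⊆FU : V ∖ c ∖ A ⊆ FU
      F⊆FU v p = ∈∖ U c′ (∈∖ V A (∖⊆ V c v v∈F) v∉A) (trans (≡-sym (c≡c′ v v∉A)) (∖∉ V c v v∈F))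
        where
        v∈F : v ∈ V ∖ c
        v∈F = ∖⊆ (V ∖ c) A v p
        v∉A : A v ≡ false
        v∉A = ∖∉ (V ∖ c) A v p

      MU⊆M′ : MU ⊆ V′ ∩ c′
      MU⊆M′ v p = ∈∩ V′ c′ (U⊆V′ v (∩⊆ˡ U c′ v p)) (∩⊆ʳ U c′ v p)

      -- The type `suc D` alone exceeds the degree bound of M.
      r∉c′ : c′ r ≡ false
      r∉c′ = ¬-not λ r∈c′ → <⇒≱ ≤-refl (begin
        suc D                       ≡⟨ cong (λ b → if b then suc D else raise j (λ v → dM v * κ v) r) (∈｛｝ r) ⟨
        j′ r                        ≤⟨ m≤m+n (j′ r) _ ⟩
        j′ r + ⟨ V′ ∩ c′ , a′ r ⟩   ≤⟨ C′.degM r (∈∩ V′ c′ r∈V′ r∈c′) ⟩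
        D ∎)

      room : ∀ v → v ∈ MU → j v + dM v * κ v + ⟨ V′ ∩ c′ , a′ v ⟩ ≤ D
      room v p = ≤-trans (+-monoˡ-≤ _ (≤-trans (uncap (j v + dM v * κ v) capped) (≤-reflexive (≡-sym j′≡)))) deg′
        where
        deg′ : j′ v + ⟨ V′ ∩ c′ , a′ v ⟩ ≤ D
        deg′ = C′.degM v (MU⊆M′ v p)
        j′≡ : j′ v ≡ raise j (λ v → dM v * κ v) v
        j′≡ = cong (λ b → if b then suc D else raise j (λ v → dM v * κ v) v) (U≢r (∩⊆ˡ U c′ v p))
        capped : raise j (λ v → dM v * κ v) v ≤ D
        capped = ≤-trans (≤-reflexive (≡-sym j′≡)) (≤-trans (m≤m+n _ _) deg′)

      -- Outside `Z`, one neighbour in `MA` already raises the type to `suc D`. Hence every edge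
      -- between the M-parts of `A` and `U` ends in `Z`.
      dM≤Z : ∀ v → v ∈ MU → dM v ≤ [ Z v ]
      dM≤Z v p with Z v in eq
      ... | true  = ≤-trans (dM≤dA v) (one-nbr v (∩⊆ˡ U c′ v p))
      ... | false with dM v in eqM
      ...   | zero  = z≤n
      ...   | suc m = contradiction (begin
        suc D                                              ≤⟨ m≤m+n (suc D) (m * suc D) ⟩
        suc m * suc D                                      ≡⟨ cong₂ (λ p b → p * (if b then 1 else suc D)) eqM eq ⟨
        dM v * κ v                                         ≤⟨ m≤n+m _ (j v) ⟩
        j v + dM v * κ v                                   ≤⟨ m≤m+n _ _ ⟩
        j v + dM v * κ v + ⟨ V′ ∩ c′ , a′ v ⟩              ≤⟨ room v p ⟩
        D ∎) (<⇒≱ ≤-refl)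

      cross-∅ : ∀ {X} Y → (∀ v → X v ≡ false) → ⟨ Y , (λ u → ⟨ X , a u ⟩) ⟩ ≡ 0
      cross-∅ {X} Y e = ⟨⟩-zero Y λ u _ → ⟨⟩-zero X λ v p → ∉∅ {X} e p

      module Parts (S : VSet) where
        S₁ S₂ : VSet
        S₁ = S ∩ A
        S₂ = S ∖ A
        cross : ℕ
        cross = ⟨ S₂ , (λ u → ⟨ S₁ , a u ⟩) ⟩
        edges-S : edges a S ≡ edges a S₁ + edges a S₂ + cross
        edges-S = trans (edges-split (split-by A S)) (cong (edges a S₁ + edges a S₂ +_) (cross-sym S₁ S₂))
        size-S : size S ≡ size S₁ + size S₂
        size-S = ⟨⟩-split (const 1) (split-by A S)
        ∉S₁⇒∈S₂ : (∀ v → S₁ v ≡ false) → ∀ {x} → x ∈ S → x ∈ S₂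
        ∉S₁⇒∈S₂ e {x} p = ∈∖ S A p (trans (cong (_∧ A x) (≡-sym p)) (e x))
        ∉S₂⇒∈S₁ : (∀ v → S₂ v ≡ false) → ∀ {x} → x ∈ S → x ∈ S₁
        ∉S₂⇒∈S₁ e {x} p = ∈∩ S A p (not-false (trans (cong (_∧ not (A x)) (≡-sym p)) (e x)))
          where
          not-false : ∀ {b} → not b ≡ false → b ≡ true
          not-false {true} _ = refl
        only-S₂ : (∀ v → S₁ v ≡ false) → edges a S₂ < size S₂ → edges a S < size S
        only-S₂ e h = begin-strict
          edges a S                           ≡⟨ edges-S ⟩
          edges a S₁ + edges a S₂ + cross     ≡⟨ cong₂ (λ p q → p + edges a S₂ + q) (edges-∅ isGraph {S₁} e) (cross-∅ {S₁} S₂ e) ⟩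
          edges a S₂ + 0                      ≡⟨ +-identityʳ _ ⟩
          edges a S₂                          <⟨ h ⟩
          size S₂                             ≤⟨ m≤n+m _ _ ⟩
          size S₁ + size S₂                   ≡⟨ size-S ⟨
          size S ∎

      -- At most one edge joins the two M-parts, and two nonempty forests joined by at most one edge
      -- form a forest.
      forestM : Forest a (V ∩ c)
      forestM S S⊆M x x∈S = by-cases (any∈? S₁) (any∈? S₂)
        where
        open Parts S
        S₁⊆ : S₁ ⊆ MA
        S₁⊆ v p = M⊆MA v (∈∩ (V ∩ c) A (S⊆M v (∩⊆ˡ S A v p)) (∩⊆ʳ S A v p))
        S₂⊆ : S₂ ⊆ MU
        S₂⊆ v p = M⊆MU v (∈∖ (V ∩ c) A (S⊆M v (∖⊆ S A v p)) (∖∉ S A v p))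
        cross≤1 : cross ≤ 1
        cross≤1 = begin
          cross                          ≤⟨ ⟨⟩-mono S₂ (λ v p → ≤-trans (⟨⟩-⊆ (a v) S₁⊆) (dM≤Z v (S₂⊆ v p))) ⟩
          ⟨ S₂ , (λ v → [ Z v ]) ⟩       ≤⟨ sum-mono (λ v → le (S₂ v) (Z v)) ⟩
          size Z                         ≤⟨ size-Z ⟩
          1 ∎
          where
          le : ∀ p q → [ p ] * [ q ] ≤ [ q ] * 1
          le true  q = ≤-reflexive (*-comm 1 [ q ])
          le false q = z≤n
        forest₂ : ∀ y → y ∈ S₂ → edges a S₂ < size S₂
        forest₂ y p = subst (_< size S₂) (edges-off S₂ λ v q → ∩⊆ˡ U c′ v (S₂⊆ v q))
          (C′.forestM S₂ (λ v q → MU⊆M′ v (S₂⊆ v q)) y p)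
        by-cases : (∃ λ v → v ∈ S₁) ⊎ (∀ v → S₁ v ≡ false) → (∃ λ v → v ∈ S₂) ⊎ (∀ v → S₂ v ≡ false) → edges a S < size S
        by-cases (inj₂ e) _ = only-S₂ e (forest₂ x (∉S₁⇒∈S₂ e x∈S))
        by-cases (inj₁ _) (inj₂ e) = begin-strict
          edges a S                           ≡⟨ edges-S ⟩
          edges a S₁ + edges a S₂ + cross     ≡⟨ cong₂ (λ p q → edges a S₁ + p + q) (edges-∅ isGraph {S₂} e) (⟨⟩-zero S₂ λ v p → ∉∅ {S₂} e p) ⟩
          edges a S₁ + 0 + 0                  ≡⟨ trans (+-identityʳ _) (+-identityʳ _) ⟩
          edges a S₁                          <⟨ CA.forestM S₁ S₁⊆ x (∉S₂⇒∈S₁ e x∈S) ⟩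
          size S₁                             ≤⟨ m≤m+n _ _ ⟩
          size S₁ + size S₂                   ≡⟨ size-S ⟨
          size S ∎
        by-cases (inj₁ (y₁ , p₁)) (inj₁ (y₂ , p₂)) = begin-strict
          edges a S                           ≡⟨ edges-S ⟩
          edges a S₁ + edges a S₂ + cross     ≤⟨ +-monoʳ-≤ (edges a S₁ + edges a S₂) cross≤1 ⟩
          edges a S₁ + edges a S₂ + 1         ≡⟨ +-assoc (edges a S₁) _ 1 ⟩
          edges a S₁ + (edges a S₂ + 1)       <⟨ +-mono-<-≤ (CA.forestM S₁ S₁⊆ y₁ p₁) (≤-trans (≤-reflexive (+-comm _ 1)) (forest₂ y₂ p₂)) ⟩
          size S₁ + size S₂                   ≡⟨ size-S ⟨
          size S ∎

      -- Adding `r` to `S₂` in the contracted graph counts all edges from `S₂` to `FA`, so `S₂`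
      -- together with its cross edges has at most `size S₂` edges. The strict inequality comes from
      -- the part inside `FA`.
      forestF : Forest a (V ∖ c)
      forestF S S⊆F x x∈S = by-cases (any∈? S₁)
        where
        open Parts S
        S₁⊆ : S₁ ⊆ FA
        S₁⊆ v p = F⊆FA v (∈∩ (V ∖ c) A (S⊆F v (∩⊆ˡ S A v p)) (∩⊆ʳ S A v p))
        S₂⊆ : S₂ ⊆ FU
        S₂⊆ v p = F⊆FU v (∈∖ (V ∖ c) A (S⊆F v (∖⊆ S A v p)) (∖∉ S A v p))
        S₂⊆U : S₂ ⊆ U
        S₂⊆U v p = ∖⊆ U c′ v (S₂⊆ v p)
        S₂⊆′ : S₂ ⊆ V′ ∖ c′
        S₂⊆′ v p = ∈∖ V′ c′ (U⊆V′ v (S₂⊆U v p)) (∖∉ U c′ v (S₂⊆ v p))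
        S′ : VSet
        S′ = S₂ ∪ ｛ r ｝
        S′⊆ : S′ ⊆ V′ ∖ c′
        S′⊆ = ∪⊆ S₂⊆′ λ v p → subst (_∈ (V′ ∖ c′)) (≡-sym (∈｛｝⇒≡ r v p)) (∈∖ V′ c′ r∈V′ r∉c′)
        r∉S₂ : ∀ v → v ∈ ｛ r ｝ → S₂ v ≡ false
        r∉S₂ v p = ¬-not λ q → contradiction (trans (≡-sym p) (U≢r (S₂⊆U v q))) λ ()
        S′-split : S′ ≐ S₂ ⊍ ｛ r ｝
        S′-split = split-∪ S₂ ｛ r ｝ r∉S₂
        edges-S′ : edges a′ S′ ≡ edges a S₂ + ⟨ S₂ , dF ⟩
        edges-S′ = trans (GraphLemmas.edges-split isGraph′ S′-split) (cong₂ _+_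
          (trans (cong₂ _+_ (edges-off S₂ S₂⊆U) (GraphLemmas.edges-small isGraph′ ｛ r ｝ (≤-reflexive (⟨｛｝⟩ r (const 1))))) (+-identityʳ _))
          (⟨⟩-cong S₂ λ v p → trans (⟨｛｝⟩ r (a′ v)) (trans (IsGraph.symm isGraph′ v r) (a′-r (U≢r (S₂⊆U v p))))))
        size-S′ : size S′ ≡ size S₂ + 1
        size-S′ = trans (⟨⟩-split (const 1) S′-split) (cong (size S₂ +_) (⟨｛｝⟩ r (const 1)))
        r∈S′ : r ∈ S′
        r∈S′ = trans (cong (S₂ r ∨_) (∈｛｝ r)) (∨-zeroʳ (S₂ r))
        contracted : edges a S₂ + cross ≤ size S₂
        contracted = ≤-pred (begin
          suc (edges a S₂ + cross)           ≤⟨ s≤s (+-monoʳ-≤ (edges a S₂) (⟨⟩-mono S₂ λ v _ → ⟨⟩-⊆ (a v) S₁⊆)) ⟩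
          suc (edges a S₂ + ⟨ S₂ , dF ⟩)     ≡⟨ cong suc edges-S′ ⟨
          suc (edges a′ S′)                  ≤⟨ C′.forestF S′ S′⊆ r r∈S′ ⟩
          size S′                            ≡⟨ trans size-S′ (+-comm _ 1) ⟩
          suc (size S₂) ∎)
        by-cases : (∃ λ v → v ∈ S₁) ⊎ (∀ v → S₁ v ≡ false) → edges a S < size S
        by-cases (inj₂ e) = only-S₂ e (subst (_< size S₂) (edges-off S₂ S₂⊆U) (C′.forestF S₂ S₂⊆′ x (∉S₁⇒∈S₂ e x∈S)))
        by-cases (inj₁ (y , p)) = begin-strict
          edges a S                            ≡⟨ edges-S ⟩
          edges a S₁ + edges a S₂ + cross      ≡⟨ +-assoc (edges a S₁) _ cross ⟩
          edges a S₁ + (edges a S₂ + cross)    <⟨ +-mono-<-≤ (CA.forestF S₁ S₁⊆ y p) contracted ⟩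
          size S₁ + size S₂                    ≡⟨ size-S ⟨
          size S ∎

      deg-split : ∀ v → ⟨ V ∩ c , a v ⟩ ≤ dM v + ⟨ MU , a v ⟩
      deg-split v = ≤-trans (≤-reflexive (⟨⟩-split (a v) (split-by A (V ∩ c))))
        (+-mono-≤ (⟨⟩-⊆ (a v) M⊆MA) (⟨⟩-⊆ (a v) M⊆MU))

      -- The new M-neighbours of `v` lie in `Z`, and `colA` was found with types already raised by
      -- the edges to `Z`.
      degM-A : ∀ v → v ∈ MA → j v + ⟨ V ∩ c , a v ⟩ ≤ D
      degM-A v v∈MA = begin
        j v + ⟨ V ∩ c , a v ⟩                          ≤⟨ +-monoʳ-≤ (j v) (deg-split v) ⟩
        j v + (dM v + ⟨ MU , a v ⟩)                    ≤⟨ +-monoʳ-≤ (j v) (+-monoʳ-≤ (dM v) (sum-mono to-Z)) ⟩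
        j v + (dM v + ⟨ Z , a v ⟩)                     ≡⟨ rearrange (j v) (dM v) ⟨ Z , a v ⟩ ⟩
        j v + ⟨ Z , a v ⟩ + dM v                       ≤⟨ +-monoˡ-≤ (dM v) (uncap (j v + ⟨ Z , a v ⟩) (≤-trans (m≤m+n _ (dM v)) (CA.degM v v∈MA))) ⟩
        raise j (λ m → ⟨ Z , a m ⟩) v + dM v           ≤⟨ CA.degM v v∈MA ⟩
        D ∎
        where
        rearrange : ∀ x y z → x + (y + z) ≡ x + z + y
        rearrange x y z = solve (x ∷ y ∷ z ∷ [])
        to-Z : ∀ u → [ MU u ] * a v u ≤ [ Z u ] * a v u
        to-Z u with MU u in eq
        ... | false = z≤n
        ... | true  = subst (_≤ [ Z u ] * a v u) (≡-sym (*-identityˡ (a v u))) (bool-bound (Z u) (begin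
          a v u    ≡⟨ symm v u ⟩
          a u v    ≤⟨ ⟨⟩-∈ MA (a u) v∈MA ⟩
          dM u     ≤⟨ dM≤Z u eq ⟩
          [ Z u ]  ∎))
          where
          bool-bound : ∀ b {x} → x ≤ [ b ] → x ≤ [ b ] * x
          bool-bound true  {x} h = ≤-reflexive (≡-sym (*-identityˡ x))
          bool-bound false h = h

      -- The type of `v` in the contracted graph already includes its neighbours in `MA`, since each
      -- raised it by at least 1.
      degM-U : ∀ v → v ∈ MU → j v + ⟨ V ∩ c , a v ⟩ ≤ D
      degM-U v v∈MU = begin
        j v + ⟨ V ∩ c , a v ⟩                          ≤⟨ +-monoʳ-≤ (j v) (deg-split v) ⟩
        j v + (dM v + ⟨ MU , a v ⟩)                    ≡⟨ +-assoc (j v) (dM v) _ ⟨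
        j v + dM v + ⟨ MU , a v ⟩                      ≤⟨ +-mono-≤ (+-monoʳ-≤ (j v) dM≤dMκ) MU≤ ⟩
        j v + dM v * κ v + ⟨ V′ ∩ c′ , a′ v ⟩          ≤⟨ room v v∈MU ⟩
        D ∎
        where
        dM≤dMκ : dM v ≤ dM v * κ v
        dM≤dMκ = ≤-trans (≤-reflexive (≡-sym (*-identityʳ (dM v)))) (*-monoʳ-≤ (dM v) (1≤κ v))
        MU≤ : ⟨ MU , a v ⟩ ≤ ⟨ V′ ∩ c′ , a′ v ⟩
        MU≤ = ≤-trans
          (≤-reflexive (⟨⟩-cong MU λ u p → ≡-sym (a′-off (U≢r (∩⊆ˡ U c′ v v∈MU)) (U≢r (∩⊆ˡ U c′ u p)))))
          (⟨⟩-⊆ (a′ v) MU⊆M′)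

      degM : ∀ v → v ∈ V ∩ c → j v + ⟨ V ∩ c , a v ⟩ ≤ D
      degM v p = by-cases (A v) refl
        where
        by-cases : ∀ b → A v ≡ b → j v + ⟨ V ∩ c , a v ⟩ ≤ D
        by-cases true  eq = degM-A v (M⊆MA v (∈∩ (V ∩ c) A p eq))
        by-cases false eq = degM-U v (M⊆MU v (∈∖ (V ∩ c) A p eq))

-- Search for a minimising vertex set.

module Minimise (n : ℕ) where
  open VertexSets n

  module _ {Q : VSet → Set} (Q? : ∀ P → Dec (Q P)) (Q-≗ : ∀ {P P′} → P ≗ P′ → Q P → Q P′) where

    -- The finite search runs over `Subset n`; its witnesses agree with functions only pointwise,
    -- hence the requirement that `Q` respect `≗`.
    any-set? : Dec (∃ Q)
    any-set? with anySubset? (λ s → Q? (lookup s))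
    ... | yes (s , q) = yes (lookup s , q)
    ... | no ¬q       = no λ (P , q) → ¬q (tabulate P , Q-≗ (λ v → ≡-sym (lookup∘tabulate P v)) q)

  module _ {Q : VSet → Set} (Q? : ∀ P → Dec (Q P)) (Q-≗ : ∀ {P P′} → P ≗ P′ → Q P → Q P′)
           (μ : VSet → ℕ) (μ-≗ : ∀ {P P′} → P ≗ P′ → μ P ≡ μ P′) where

    -- Descent: any strictly better set replaces `P`, and `k` bounds the number of replacements.
    argmin : ∀ k P → Q P → μ P ≤ k → ∃ λ A → Q A × (∀ B → Q B → μ A ≤ μ B)
    argmin k P q h with any-set? (λ B → Q? B ×-dec μ B <? μ P) (λ eq (q , lt) → Q-≗ eq q , subst (_< μ P) (μ-≗ eq) lt)
    ... | no ¬smaller = P , q , λ B qB → ≮⇒≥ λ lt → ¬smaller (B , qB , lt)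
    argmin zero    P q h | yes (B , qB , lt) with () ← <-≤-trans lt h
    argmin (suc k) P q h | yes (B , qB , lt) = argmin k B qB (≤-pred (≤-trans lt h))

-- The induction on the number of vertices.

module Induction (n D : ℕ) (2≤D : 2 ≤ D) where

  open VertexSets n
  open Colour n D
  open Gluing n D
  open Minimise n

  -- Turns a comparison of truncated differences into one of sums, given that neither difference is
  -- truncated.
  ∸-mono⇒+ : ∀ {m p q s} → p ≤ m → s ≤ q → m ∸ p ≤ q ∸ s → m + s ≤ q + p
  ∸-mono⇒+ {m} {p} {q} {s} p≤m s≤q h = begin
    m + s             ≡⟨ cong (_+ s) (m∸n+n≡m p≤m) ⟨
    m ∸ p + p + s     ≤⟨ +-monoˡ-≤ s (+-monoˡ-≤ p h) ⟩
    q ∸ s + p + s     ≡⟨ exch (q ∸ s) p s ⟩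
    q ∸ s + s + p     ≡⟨ cong (_+ p) (m∸n+n≡m s≤q) ⟩
    q + p ∎
    where
    open ≤-Reasoning
    exch : ∀ x y z → x + y + z ≡ x + z + y
    exch x y z = solve (x ∷ y ∷ z ∷ [])

  module Step
    {a : Weight} {j : Fin n → ℕ} {V : VSet} (adm : Admissible a j V)
    (ih : ∀ {a′ j′ V′} → size V′ < size V → Admissible a′ j′ V′ → ∃ (Colouring a′ j′ V′))
    where

    open Admissible adm
    open IsGraph isGraph
    open GraphLemmas isGraph

    restrict : ∀ {ĵ V₀} → V₀ ⊆ V → (∀ v → ĵ v ≤ suc D) → Sparseⱼ a ĵ V₀ → Admissible a ĵ V₀
    restrict V₀⊆V ĵ≤ sp = record
      { isGraph = isGraph
      ; simple  = λ u v p q → simple u v (V₀⊆V u p) (V₀⊆V v q)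
      ; j≤1+D   = ĵ≤
      ; sparse  = sp
      }

    deg : Fin n → ℕ
    deg v = ⟨ V , a v ⟩

    size-delete : ∀ {v} → v ∈ V → suc (size (V ∖ ｛ v ｝)) ≡ size V
    size-delete {v} v∈V = ≡-sym (trans (size-vertex isGraph V v) (cong (λ b → [ b ] + size (V ∖ ｛ v ｝)) v∈V))

    deg-split : ∀ c v → ⟨ (V ∖ ｛ v ｝) ∩ c , a v ⟩ + ⟨ V ∖ ｛ v ｝ ∖ c , a v ⟩ ≤ deg v
    deg-split c v = ≤-trans
      (≤-reflexive (≡-sym (⟨⟩-split (a v) (split-by c (V ∖ ｛ v ｝)))))
      (⟨⟩-⊆ (a v) (∖⊆ V ｛ v ｝))

    Light Cubic : Fin n → Set
    Light v = deg v ≤ 1 ⊎ (deg v ≤ 2 × j v ≤ D)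
    Cubic v = deg v ≤ 3 × j v < D

    light? : ∀ v → Dec (Light v)
    light? v = (deg v ≤? 1) ⊎-dec ((deg v ≤? 2) ×-dec (j v ≤? D))

    cubic? : ∀ v → Dec (Cubic v)
    cubic? v = (deg v ≤? 3) ×-dec (j v <? D)

    -- With at most one F-neighbour, `v` joins F. Otherwise it has exactly two neighbours, both in
    -- F, and its type ≤ D lets it join M as an isolated vertex.
    delete-light : ∀ {v} → v ∈ V → Light v → ∃ (Colouring a j V)
    delete-light {v} v∈V light with ih (≤-reflexive (size-delete v∈V)) (restrict (∖⊆ V ｛ v ｝) j≤1+D λ P P⊆ → sparse P λ u p → ∖⊆ V ｛ v ｝ u (P⊆ u p))
    ... | c , col with ⟨ V ∖ ｛ v ｝ ∖ c , a v ⟩ ≤? 1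
    ... | yes dF≤1 = _ , extendF isGraph (λ _ → ≤-refl) v∈V col dF≤1
    ... | no dF≰1 = _ , extendM isGraph (λ _ → ≤-refl) v∈V col (≤-trans (≤-reflexive dM≡0) z≤n)
        (subst (λ d → j v + d ≤ D) (≡-sym dM≡0) (subst (_≤ D) (≡-sym (+-identityʳ (j v))) (proj₂ bounds)))
        (λ u p → ≤-reflexive (trans (cong (j u +_) (n≤0⇒n≡0 (≤-trans (⟨⟩-∈ X (a v) p) (≤-reflexive dM≡0)))) (+-identityʳ (j u))))
      where
      X : VSet
      X = (V ∖ ｛ v ｝) ∩ c
      dF≤deg : ⟨ V ∖ ｛ v ｝ ∖ c , a v ⟩ ≤ deg v
      dF≤deg = ≤-trans (m≤n+m _ ⟨ X , a v ⟩) (deg-split c v)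
      bounds : deg v ≤ 2 × j v ≤ D
      bounds = fromInj₂ (λ deg≤1 → contradiction (≤-trans dF≤deg deg≤1) dF≰1) light
      dM≡0 : ⟨ X , a v ⟩ ≡ 0
      dM≡0 = n≤0⇒n≡0 (+-cancelʳ-≤ 2 _ 0 (≤-trans (+-monoʳ-≤ ⟨ X , a v ⟩ (≰⇒> dF≰1)) (≤-trans (deg-split c v) (proj₁ bounds))))

    record Proper (P : VSet) : Set where
      field
        ⊆V    : P ⊆ V
        other : ∃ λ w → w ∈ V ∖ P
        2≤    : 2 ≤ size P
    open Proper

    proper? : ∀ P → Dec (Proper P)
    proper? P with all? (λ v → (P v Bool.≟ true) →-dec (V v Bool.≟ true)) | any? (λ w → (V ∖ P) w Bool.≟ true) | 2 ≤? size P
    ... | yes p | yes q | yes s = yes record { ⊆V = p ; other = q ; 2≤ = s }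
    ... | no ¬p | _     | _     = no λ pr → ¬p (⊆V pr)
    ... | _     | no ¬q | _     = no λ pr → ¬q (other pr)
    ... | _     | _     | no ¬s = no λ pr → ¬s (2≤ pr)

    proper-≗ : ∀ {P P′} → P ≗ P′ → Proper P → Proper P′
    proper-≗ {P} {P′} eq pr = record
      { ⊆V    = λ v p → ⊆V pr v (trans (eq v) p)
      ; other = proj₁ (other pr) , trans (cong (λ b → V (proj₁ (other pr)) ∧ not b) (≡-sym (eq _))) (proj₂ (other pr))
      ; 2≤    = ≤-trans (2≤ pr) (≤-reflexive (⟨⟩-≗ (const 1) eq))
      }

    -- That is, ρ ≥ 3D + 1 on all proper subsets with at least two vertices.
    Gap : Set
    Gap = ∀ P → Proper P → K a j P + 3 * suc D ≤ W P + 2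

    -- With two or more F-neighbours, at most one neighbour is left in M; its raised type has
    -- reserved room for `v`, and the type of `v`, being below D, allows one M-neighbour.
    delete-cubic : Gap → ∀ {v} → v ∈ V → Cubic v → ∃ (Colouring a j V)
    delete-cubic gap {v} v∈V (deg≤3 , j<D) with ih (≤-reflexive (size-delete v∈V)) (restrict (∖⊆ V ｛ v ｝) (λ u → m⊓n≤n _ (suc D)) raised)
      where
      raised : Sparseⱼ a (raise j (a v)) (V ∖ ｛ v ｝)
      raised = raise-sparse isGraph (a v) 3 (≤-trans (⟨⟩-⊆ (a v) (∖⊆ V ｛ v ｝)) deg≤3) λ P P⊆ two →
        -- Raising three types costs 9, which is at most 3(D + 1) because D ≥ 2.
        ≤-trans (+-monoʳ-≤ (K a j P) (scale 3 (s≤s 2≤D))) (gap P record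
          { ⊆V    = λ u p → ∖⊆ V ｛ v ｝ u (P⊆ u p)
          ; other = v , ∈∖ V P v∈V (¬-not λ v∈P → contradiction (trans (≡-sym (∈｛｝ v)) (∖∉ V ｛ v ｝ v (P⊆ v v∈P))) λ ())
          ; 2≤    = two
          })
    ... | c , col with ⟨ V ∖ ｛ v ｝ ∖ c , a v ⟩ ≤? 1
    ... | yes dF≤1 = _ , extendF isGraph (λ u → ⊓-glb (m≤m+n (j u) (a v u)) (j≤1+D u)) v∈V col dF≤1
    ... | no dF≰1 = _ , extendM isGraph (λ u → ⊓-glb (m≤m+n (j u) (a v u)) (j≤1+D u)) v∈V col dM≤1
        (≤-trans (+-monoʳ-≤ (j v) dM≤1) (subst (_≤ D) (+-comm 1 (j v)) j<D))
        (λ u p → uncap (j u + a v u) (≤-trans (m≤m+n _ _) (Colouring.degM col u p)))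
      where
      dM≤1 : ⟨ (V ∖ ｛ v ｝) ∩ c , a v ⟩ ≤ 1
      dM≤1 = +-cancelʳ-≤ 2 _ 1 (≤-trans (+-monoʳ-≤ _ (≰⇒> dF≰1)) (≤-trans (deg-split c v) deg≤3))

    -- Colouring along a minimiser of low potential.

    module LowSet
      (no-light : ∀ v → v ∈ V → ¬ Light v)
      {A : VSet} (A-proper : Proper A)
      -- In terms of ρ, `low` reads ρ(A) ≤ 3D and `minimal` reads ρ(A) ≤ ρ(B).
      (low : W A ≤ K a j A + 3 * D)
      (minimal : ∀ B → Proper B → W A + K a j B ≤ W B + K a j A)
      where

      A⊆V : A ⊆ V
      A⊆V = ⊆V A-proper

      K-｛｝ : ∀ v → K a j ｛ v ｝ ≡ 3 * j v
      K-｛｝ v = trans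
        (cong₂ (λ e w → 3 * suc D * e + 3 * w) (edges-small ｛ v ｝ (≤-reflexive (⟨｛｝⟩ v (const 1)))) (⟨｛｝⟩ v j))
        (cong (_+ 3 * j v) (*-zeroʳ (3 * suc D)))

      module _ {v : Fin n} (v∈U : v ∈ V ∖ A) where

        B : VSet
        B = A ∪ ｛ v ｝

        B-split : B ≐ A ⊍ ｛ v ｝
        B-split = split-∪ A ｛ v ｝ λ u p → subst (λ x → A x ≡ false) (≡-sym (∈｛｝⇒≡ v u p)) (∖∉ V A v v∈U)

        B⊆V : B ⊆ V
        B⊆V = ∪⊆ A⊆V λ u p → subst (_∈ V) (≡-sym (∈｛｝⇒≡ v u p)) (∖⊆ V A v v∈U)

        K-B : K a j B ≡ K a j A + 3 * j v + 3 * suc D * ⟨ A , a v ⟩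
        K-B = trans (K-split isGraph j B-split)
          (cong₂ (λ x y → K a j A + x + 3 * suc D * y) (K-｛｝ v) (⟨｛｝⟩ v (λ u → ⟨ A , a u ⟩)))

        W-B : W B ≡ W A + (6 * D + 5)
        W-B = trans (W-split B-split) (cong (W A +_) (trans (cong ((6 * D + 5) *_) (⟨｛｝⟩ v (const 1))) (*-identityʳ (6 * D + 5))))

        -- Adding a vertex with two neighbours in `A` changes ρ by at most 6D + 5 - 6(D + 1) = -1,
        -- against minimality as long as `B` is proper.
        one-nbr : ⟨ A , a v ⟩ ≤ 1
        one-nbr with ⟨ A , a v ⟩ ≤? 1
        ... | yes h = h
        ... | no h with any∈? (V ∖ B)
        ...   | inj₁ w = ⊥-elim (absurd D (W A) (K a j A) (j v) ⟨ A , a v ⟩ (≰⇒> h)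
                  (subst₂ (λ k w → W A + k ≤ w + K a j A) K-B W-B (minimal B B-proper)))
          where
          B-proper : Proper B
          B-proper = record { ⊆V = B⊆V ; other = w ; 2≤ = ≤-trans (2≤ A-proper) (⟨⟩-⊆ (const 1) (∪⊇ˡ A ｛ v ｝)) }
          absurd : ∀ D w k j d → 2 ≤ d → w + (k + 3 * j + 3 * suc D * d) ≤ w + (6 * D + 5) + k → ⊥
          absurd D w k j d h₁ h₂ = <⇒≱ ≤-refl (lin {b = 1} {c = 0} (3 * j) (+-mono-≤ (scale (3 * suc D) h₁) h₂) (solve (D ∷ w ∷ k ∷ j ∷ d ∷ [])))
        -- Here `B` is all of `V`, so every neighbour of `v` lies in `A`. Degree at least 3, or
        -- degree 2 with type `suc D` since `v` is not light, brings ρ(B) down to at most -4.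
        ...   | inj₂ e = ⊥-elim (by-cases (3 ≤? ⟨ A , a v ⟩))
          where
          V⊆B : V ⊆ B
          V⊆B u u∈V with B u in eq
          ... | true  = refl
          ... | false with () ← trans (≡-sym (∈∖ V B u∈V eq)) (e u)
          deg≤ : deg v ≤ ⟨ A , a v ⟩
          deg≤ = begin
            deg v                             ≤⟨ ⟨⟩-⊆ (a v) V⊆B ⟩
            ⟨ B , a v ⟩                       ≡⟨ ⟨⟩-split (a v) B-split ⟩
            ⟨ A , a v ⟩ + ⟨ ｛ v ｝ , a v ⟩    ≡⟨ cong (⟨ A , a v ⟩ +_) (trans (⟨｛｝⟩ v (a v)) (diag v)) ⟩
            ⟨ A , a v ⟩ + 0                   ≡⟨ +-identityʳ _ ⟩
            ⟨ A , a v ⟩ ∎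
            where open ≤-Reasoning
          sparse-B : K a j A + 3 * j v + 3 * suc D * ⟨ A , a v ⟩ ≤ W A + (6 * D + 5) + 2
          sparse-B = subst₂ (λ k w → k ≤ w + 2) K-B W-B (sparse B B⊆V)
          absurd₃ : ∀ D w k j d → 3 ≤ d → k + 3 * j + 3 * suc D * d ≤ w + (6 * D + 5) + 2 → w ≤ k + 3 * D → ⊥
          absurd₃ D w k j d h₁ h₂ h₃ = <⇒≱ ≤-refl (lin {b = 1} {c = 0} (1 + 3 * j) (+-mono-≤ (scale (3 * suc D) h₁) (+-mono-≤ h₂ h₃)) (solve (D ∷ w ∷ k ∷ j ∷ d ∷ [])))
          absurd₂ : ∀ D w k j d → 2 ≤ d → suc D ≤ j → k + 3 * j + 3 * suc D * d ≤ w + (6 * D + 5) + 2 → w ≤ k + 3 * D → ⊥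
          absurd₂ D w k j d h₁ h₂ h₃ h₄ = <⇒≱ ≤-refl (lin {b = 1} {c = 0} 1 (+-mono-≤ (+-mono-≤ (scale (3 * suc D) h₁) (scale 3 h₂)) (+-mono-≤ h₃ h₄)) (solve (D ∷ w ∷ k ∷ j ∷ d ∷ [])))
          by-cases : Dec (3 ≤ ⟨ A , a v ⟩) → ⊥
          by-cases (yes three) = absurd₃ D (W A) (K a j A) (j v) ⟨ A , a v ⟩ three sparse-B low
          by-cases (no ¬three) = absurd₂ D (W A) (K a j A) (j v) ⟨ A , a v ⟩ (≰⇒> h)
            (≰⇒> λ j≤D → no-light v (∖⊆ V A v v∈U) (inj₂ (≤-trans deg≤ (≤-pred (≰⇒> ¬three)) , j≤D))) sparse-B low

      rep : ∃ λ r → r ∈ A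
      rep with any∈? A
      ... | inj₁ r = r
      ... | inj₂ e = contradiction (2≤ A-proper) (<⇒≱ (≤-trans (s≤s (≤-reflexive (⟨⟩-zero A λ v p → ∉∅ {A} e p))) (s≤s z≤n)))

      size-V : size A + size (V ∖ A) ≤ size V
      size-V = ≤-trans (+-monoˡ-≤ (size (V ∖ A)) (⟨⟩-⊆ (const 1) λ v p → ∈∩ V A (A⊆V v p) p))
        (≤-reflexive (≡-sym (⟨⟩-split (const 1) (split-by A V))))

      size-A< : size A < size V
      size-A< = ≤-trans (≤-reflexive (+-comm 1 (size A)))
        (≤-trans (+-monoʳ-≤ (size A) (⟨⟩-∈ (V ∖ A) (const 1) (proj₂ (other A-proper)))) size-V)

      -- The induction hypothesis is used twice: on `A`, which misses a vertex of `V`, and on the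
      -- contracted graph, where at least two vertices of `A` became one.
      glue-along : ∀ Z → size Z ≤ 1 → (∀ v → v ∈ Z → v ∈ V ∖ A → 1 ≤ ⟨ A , a v ⟩) →
        (∀ Q → Q ⊆ V ∖ A → ⟨ Q , (λ v → [ Z v ]) ⟩ ≡ 0 →
          K a j Q + 3 * suc D * ⟨ Q , (λ v → ⟨ A , a v ⟩) ⟩ ≤ W Q + 2) →
        Sparseⱼ a (raise j (λ m → ⟨ Z , a m ⟩)) A → ∃ (Colouring a j V)
      glue-along Z size-Z Z-nbr avoid-Z sparse-A with ih size-A< (restrict A⊆V (λ v → m⊓n≤n _ (suc D)) sparse-A)
      ... | cA , colA = _ , glue (proj₂ (ih size-V′< admissible′))
        where
        open Glue adm A⊆V (proj₂ rep) (λ v → one-nbr {v}) low size-Z Z-nbr avoid-Z colA using (glue; admissible′; V′; U; U≢r)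
        r : Fin n
        r = proj₁ rep
        size-V′< : size V′ < size V
        size-V′< = begin-strict
          size V′                  ≡⟨ ⟨⟩-split (const 1) (split-∪ U ｛ r ｝ λ v p → ¬-not λ q → contradiction (trans (≡-sym p) (U≢r q)) λ ()) ⟩
          size U + size ｛ r ｝     ≡⟨ cong (size U +_) (⟨｛｝⟩ r (const 1)) ⟩
          size U + 1               <⟨ +-monoʳ-< (size U) (2≤ A-proper) ⟩
          size U + size A          ≡⟨ +-comm (size U) (size A) ⟩
          size A + size U          ≤⟨ size-V ⟩
          size V ∎
          where open ≤-Reasoning

      A∪-split : ∀ Q → Q ⊆ V ∖ A → A ∪ Q ≐ A ⊍ Q
      A∪-split Q Q⊆U = split-∪ A Q λ v p → ∖∉ V A v (Q⊆U v p)

      A∪⊆V : ∀ Q → Q ⊆ V ∖ A → A ∪ Q ⊆ V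
      A∪⊆V Q Q⊆U = ∪⊆ A⊆V λ v p → ∖⊆ V A v (Q⊆U v p)

      -- With `Z` empty the types on `A` stay as they are, and `A` inherits its sparsity from `V`.
      glue-plain : (∀ Q → Q ⊆ V ∖ A → K a j Q + 3 * suc D * ⟨ Q , (λ v → ⟨ A , a v ⟩) ⟩ ≤ W Q + 2) → ∃ (Colouring a j V)
      glue-plain h = glue-along ∅ (≤-trans (≤-reflexive (⟨∅⟩ (const 1))) z≤n) (λ _ ()) (λ Q Q⊆U _ → h Q Q⊆U)
        (raise-sparse isGraph (λ m → ⟨ ∅ , a m ⟩) 0
          (≤-reflexive (⟨⟩-zero A λ m _ → ⟨∅⟩ (a m)))
          λ P P⊆A _ → ≤-trans (≤-reflexive (+-identityʳ (K a j P))) (sparse P λ v p → A⊆V v (P⊆A v p)))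

      glue-isolated : (∀ v → v ∈ V ∖ A → ⟨ A , a v ⟩ ≡ 0) → ∃ (Colouring a j V)
      glue-isolated h = glue-plain λ Q Q⊆U → begin
        K a j Q + 3 * suc D * ⟨ Q , (λ v → ⟨ A , a v ⟩) ⟩  ≡⟨ cong (λ d → K a j Q + 3 * suc D * d) (⟨⟩-zero Q λ v p → h v (Q⊆U v p)) ⟩
        K a j Q + 3 * suc D * 0                             ≡⟨ trans (cong (K a j Q +_) (*-zeroʳ (3 * suc D))) (+-identityʳ _) ⟩
        K a j Q                                             ≤⟨ sparse Q (λ v p → ∖⊆ V A v (Q⊆U v p)) ⟩
        W Q + 2 ∎
        where open ≤-Reasoning

      -- If ρ(A) ≤ 0, the bound ρ(A ∪ Q) ≥ -2 passes to `Q` together with its edges to `A`.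
      glue-tight : W A ≤ K a j A → ∃ (Colouring a j V)
      glue-tight tight = glue-plain λ Q Q⊆U → arith (W A) (K a j A) (K a j Q) _ (W Q) tight
        (subst₂ (λ k w → k ≤ w + 2) (K-split isGraph j (A∪-split Q Q⊆U)) (W-split (A∪-split Q Q⊆U)) (sparse (A ∪ Q) (A∪⊆V Q Q⊆U)))
        where
        arith : ∀ wA kA kQ t wQ → wA ≤ kA → kA + kQ + t ≤ wA + wQ + 2 → kQ + t ≤ wQ + 2
        arith wA kA kQ t wQ h₁ h₂ = lin 0 (+-mono-≤ h₁ h₂) (solve (wA ∷ kA ∷ kQ ∷ t ∷ wQ ∷ []))

      -- Here ρ(A) ≥ 1, so by minimality ρ ≥ 1 on all subsets of `A` with at least two vertices.
      -- This is 3 above -2 and pays for raising the type of the one neighbour of `v` in `A`. A set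
      -- `Q` avoiding `v` leaves `A ∪ Q` proper, so ρ(A ∪ Q) ≥ ρ(A).
      glue-edge : K a j A < W A → ∀ {v} → v ∈ V ∖ A → 1 ≤ ⟨ A , a v ⟩ → ∃ (Colouring a j V)
      glue-edge loose {v} v∈U nbr = glue-along ｛ v ｝ (≤-reflexive (⟨｛｝⟩ v (const 1)))
        (λ u p _ → subst (λ x → 1 ≤ ⟨ A , a x ⟩) (≡-sym (∈｛｝⇒≡ v u p)) nbr)
        avoid
        (raise-sparse isGraph (λ m → ⟨ ｛ v ｝ , a m ⟩) 1
          (≤-trans (≤-reflexive (⟨⟩-cong A λ m _ → trans (⟨｛｝⟩ v (a m)) (symm m v))) (one-nbr v∈U))
          spare)
        where
        spare : ∀ P → P ⊆ A → 2 ≤ size P → K a j P + 3 * 1 ≤ W P + 2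
        spare P P⊆A two = arith (W A) (K a j A) (W P) (K a j P) loose (minimal P record
          { ⊆V    = λ u p → A⊆V u (P⊆A u p)
          ; other = v , ∈∖ V P (∖⊆ V A v v∈U) (¬-not λ v∈P → contradiction (trans (≡-sym (P⊆A v v∈P)) (∖∉ V A v v∈U)) λ ())
          ; 2≤    = two
          })
          where
          arith : ∀ wA kA wP kP → suc kA ≤ wA → wA + kP ≤ wP + kA → kP + 3 * 1 ≤ wP + 2
          arith wA kA wP kP h₁ h₂ = lin 0 (+-mono-≤ h₁ h₂) (solve (wA ∷ kA ∷ wP ∷ kP ∷ []))
        avoid : ∀ Q → Q ⊆ V ∖ A → ⟨ Q , (λ u → [ ｛ v ｝ u ]) ⟩ ≡ 0 →
          K a j Q + 3 * suc D * ⟨ Q , (λ u → ⟨ A , a u ⟩) ⟩ ≤ W Q + 2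
        avoid Q Q⊆U eq = arith (W A) (K a j A) (K a j Q) _ (W Q)
          (subst₂ (λ k w → W A + k ≤ w + K a j A) (K-split isGraph j (A∪-split Q Q⊆U)) (W-split (A∪-split Q Q⊆U)) (minimal (A ∪ Q) record
            { ⊆V    = A∪⊆V Q Q⊆U
            ; other = v , ∈∖ V (A ∪ Q) (∖⊆ V A v v∈U) (trans (cong (_∨ Q v) (∖∉ V A v v∈U)) v∉Q)
            ; 2≤    = ≤-trans (2≤ A-proper) (⟨⟩-⊆ (const 1) (∪⊇ˡ A Q))
            }))
          where
          v∉Q : Q v ≡ false
          v∉Q = ¬-not λ v∈Q → contradiction (begin
            1                                ≡⟨ cong [_] (∈｛｝ v) ⟨
            [ ｛ v ｝ v ]                     ≤⟨ ⟨⟩-∈ Q (λ u → [ ｛ v ｝ u ]) v∈Q ⟩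
            ⟨ Q , (λ u → [ ｛ v ｝ u ]) ⟩     ≡⟨ eq ⟩
            0 ∎) λ ()
            where open ≤-Reasoning
          arith : ∀ wA kA kQ t wQ → wA + (kA + kQ + t) ≤ wA + wQ + kA → kQ + t ≤ wQ + 2
          arith wA kA kQ t wQ h = lin 2 h (solve (wA ∷ kA ∷ kQ ∷ t ∷ wQ ∷ []))

      colour-low : ∃ (Colouring a j V)
      colour-low with any? (λ v → ((V ∖ A) v Bool.≟ true) ×-dec (1 ≤? ⟨ A , a v ⟩))
      ... | no none = glue-isolated λ v p → n<1⇒n≡0 (≰⇒> λ nbr → none (v , p , nbr))
      ... | yes (v , p , nbr) with W A ≤? K a j A
      ...   | yes tight = glue-tight tight
      ...   | no loose  = glue-edge (≰⇒> loose) p nbr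

    -- Twice the share of a vertex in ρ is 2(6D + 5) - 3(D + 1)d - 6j, each edge being halved
    -- between its ends; the bound says that this is at most -2.
    charge : ∀ d j → ¬ (d ≤ 1 ⊎ (d ≤ 2 × j ≤ D)) → ¬ (d ≤ 3 × j < D) → 12 * D + 12 ≤ 3 * suc D * d + 6 * j
    charge 0 j ¬l ¬c = contradiction (inj₁ z≤n) ¬l
    charge 1 j ¬l ¬c = contradiction (inj₁ ≤-refl) ¬l
    charge 2 j ¬l ¬c = arith D j (≰⇒> λ h → ¬l (inj₂ (≤-refl , h)))
      where
      arith : ∀ D j → suc D ≤ j → 12 * D + 12 ≤ 3 * suc D * 2 + 6 * j
      arith D j h = lin 0 (scale 6 h) (solve (D ∷ j ∷ []))
    charge 3 j ¬l ¬c = arith D j 2≤D (≮⇒≥ λ h → ¬c (≤-refl , h))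
      where
      arith : ∀ D j → 2 ≤ D → D ≤ j → 12 * D + 12 ≤ 3 * suc D * 3 + 6 * j
      arith D j h₁ h₂ = lin 3 (+-mono-≤ (scale 3 h₁) (scale 6 h₂)) (solve (D ∷ j ∷ []))
    charge (suc (suc (suc (suc d)))) j _ _ = arith D d j
      where
      arith : ∀ D d j → 12 * D + 12 ≤ 3 * suc D * (4 + d) + 6 * j
      arith D d j = lin (3 * suc D * d + 6 * j) (≤-refl {0}) (solve (D ∷ d ∷ j ∷ []))

    -- Summing the charges gives ρ(V) ≤ -|V|, while sparsity gives ρ(V) ≥ -2.
    size-V≤2 : (∀ v → v ∈ V → ¬ Light v) → (∀ v → v ∈ V → ¬ Cubic v) → size V ≤ 2
    size-V≤2 ¬light ¬cubic = arith D (size V) (edges a V) ⟨ V , j ⟩ total (sparse V λ _ p → p)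
      where
      open ≤-Reasoning
      total : (12 * D + 12) * size V ≤ 3 * suc D * (edges a V + edges a V) + 6 * ⟨ V , j ⟩
      total = begin
        (12 * D + 12) * size V                                    ≡⟨ ⟨⟩-const V (12 * D + 12) ⟨
        ⟨ V , const (12 * D + 12) ⟩                               ≤⟨ ⟨⟩-mono V (λ v p → charge (deg v) (j v) (¬light v p) (¬cubic v p)) ⟩
        ⟨ V , (λ v → 3 * suc D * deg v + 6 * j v) ⟩               ≡⟨ ⟨⟩-+ V _ _ ⟩
        ⟨ V , (λ v → 3 * suc D * deg v) ⟩ + ⟨ V , (λ v → 6 * j v) ⟩ ≡⟨ cong₂ _+_ (⟨⟩-* V (3 * suc D) deg) (⟨⟩-* V 6 j) ⟩
        3 * suc D * ⟨ V , deg ⟩ + 6 * ⟨ V , j ⟩                   ≡⟨ cong (λ e → 3 * suc D * e + 6 * ⟨ V , j ⟩) (handshake V) ⟩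
        3 * suc D * (edges a V + edges a V) + 6 * ⟨ V , j ⟩ ∎
      arith : ∀ D s e t → (12 * D + 12) * s ≤ 3 * suc D * (e + e) + 6 * t → 3 * suc D * e + 3 * t ≤ (6 * D + 5) * s + 2 → s ≤ 2
      arith D s e t h₁ h₂ = *-cancelˡ-≤ 2 (lin 0 (+-mono-≤ h₁ (scale 2 h₂)) (solve (D ∷ s ∷ e ∷ t ∷ [])))

    colour-empty : (∀ v → V v ≡ false) → ∃ (Colouring a j V)
    colour-empty e = ∅ , record
      { forestM = λ S S⊆ x p → ∉∅ {V} e (∩⊆ˡ V ∅ x (S⊆ x p))
      ; forestF = λ S S⊆ x p → ∉∅ {V} e (∖⊆ V ∅ x (S⊆ x p))
      ; degM    = λ v p → ∉∅ {V} e (∩⊆ˡ V ∅ v p)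
      }

    -- A vertex that is not light has degree at least 2, and by simplicity its edges end in distinct
    -- vertices.
    many-vertices : (∀ v → v ∈ V → ¬ Light v) → ∀ {x} → x ∈ V → 3 ≤ size V
    many-vertices ¬light {x} x∈V = begin
      3                             ≤⟨ s≤s (≰⇒> (¬light x x∈V ∘ inj₁)) ⟩
      suc (deg x)                   ≡⟨ cong suc (⟨⟩-split (a x) (split-by ｛ x ｝ V)) ⟩
      suc (⟨ V ∩ ｛ x ｝ , a x ⟩ + ⟨ V ∖ ｛ x ｝ , a x ⟩)
        ≡⟨ cong (λ d → suc (d + ⟨ V ∖ ｛ x ｝ , a x ⟩)) (trans (⟨∩｛｝⟩ V x (a x)) (trans (cong ([ V x ] *_) (diag x)) (*-zeroʳ [ V x ]))) ⟩
      suc ⟨ V ∖ ｛ x ｝ , a x ⟩      ≤⟨ s≤s (⟨⟩-mono (V ∖ ｛ x ｝) λ v p → simple x v x∈V (∖⊆ V ｛ x ｝ v p)) ⟩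
      suc (size (V ∖ ｛ x ｝))       ≡⟨ size-delete x∈V ⟩
      size V ∎
      where open ≤-Reasoning

    low-or-gap : (∃ λ A → Proper A × W A ≤ K a j A + 3 * D × (∀ B → Proper B → W A + K a j B ≤ W B + K a j A)) ⊎ Gap
    low-or-gap with any-set? proper? proper-≗
    ... | no none = inj₂ λ P p → contradiction (P , p) none
    ... | yes (P , p) with argmin proper? proper-≗ μ (λ eq → cong₂ (λ w k → w + 2 ∸ k) (W-≗ eq) (K-≗ a j eq)) (μ P) P p ≤-refl
      where
      -- This is ρ + 2; sparsity makes the truncated subtraction exact on subsets of `V`.
      μ : VSet → ℕ
      μ P = W P + 2 ∸ K a j P
    ...   | A , A-proper , least = by-cases (W A ≤? K a j A + 3 * D)
      where
      arith : ∀ wA kA wB kB → wA + 2 + kB ≤ wB + 2 + kA → wA + kB ≤ wB + kA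
      arith wA kA wB kB h = lin 0 h (solve (wA ∷ kA ∷ wB ∷ kB ∷ []))
      minimal : ∀ B → Proper B → W A + K a j B ≤ W B + K a j A
      minimal B B-proper = arith (W A) (K a j A) (W B) (K a j B)
        (∸-mono⇒+ (sparse A (⊆V A-proper)) (sparse B (⊆V B-proper)) (least B B-proper))
      arith-gap : ∀ D wA kA wB kB → suc (kA + 3 * D) ≤ wA → wA + kB ≤ wB + kA → kB + 3 * suc D ≤ wB + 2
      arith-gap D wA kA wB kB h₁ h₂ = lin 0 (+-mono-≤ h₁ h₂) (solve (D ∷ wA ∷ kA ∷ wB ∷ kB ∷ []))
      by-cases : Dec (W A ≤ K a j A + 3 * D) → _
      by-cases (yes low) = inj₁ (A , A-proper , low , minimal)
      by-cases (no ¬low) = inj₂ λ B B-proper → arith-gap D (W A) (K a j A) (W B) (K a j B) (≰⇒> ¬low) (minimal B B-proper)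

    -- Light vertices are treated first, since `LowSet` and the final count rely on their absence.
    step : ∃ (Colouring a j V)
    step with any? (λ v → (V v Bool.≟ true) ×-dec light? v)
    ... | yes (v , v∈V , light) = delete-light v∈V light
    ... | no ¬light with low-or-gap
    ...   | inj₁ (A , A-proper , low , minimal) = LowSet.colour-low (λ v p l → ¬light (v , p , l)) A-proper low minimal
    ...   | inj₂ gap with any? (λ v → (V v Bool.≟ true) ×-dec cubic? v)
    ...     | yes (v , v∈V , cubic) = delete-cubic gap v∈V cubic
    ...     | no ¬cubic with any∈? V
    ...       | inj₂ e = colour-empty e
    ...       | inj₁ (x , x∈V) = contradiction
      (size-V≤2 (λ v p l → ¬light (v , p , l)) (λ v p q → ¬cubic (v , p , q)))
      (<⇒≱ (many-vertices (λ v p l → ¬light (v , p , l)) x∈V))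

  colour : ∀ k {a j V} → size V ≤ k → Admissible a j V → ∃ (Colouring a j V)
  -- At bound 0 no graph is smaller, so the induction hypothesis is vacuous.
  colour zero    h adm = Step.step adm λ lt _ → contradiction (<-≤-trans lt h) λ ()
  colour (suc k) h adm = Step.step adm λ lt → colour k (≤-pred (≤-trans lt h))

-- Translation of the given graph into weights.

sum-allFin : ∀ {m} (f : Fin m → ℕ) → sumᴸ (map f (allFin m)) ≡ sum f
sum-allFin {m} f = trans (cong sumᴸ (map-tabulate (λ i → i) f)) (sum-tabulate f)
  where
  sum-tabulate : ∀ {m} (f : Fin m → ℕ) → sumᴸ (tabulateᴸ f) ≡ sum f
  sum-tabulate {zero}  f = refl
  sum-tabulate {suc m} f = cong (f zero +_) (sum-tabulate (f ∘ suc))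

⟦⟧≡[does] : ∀ {P : Set} (d : Dec P) → ⟦ d ⟧ ≡ [ does d ]
⟦⟧≡[does] (yes _) = refl
⟦⟧≡[does] (no _)  = refl

[∧] : ∀ p q → [ p ∧ q ] ≡ [ p ] * [ q ]
[∧] true  q = ≡-sym (*-identityˡ [ q ])
[∧] false q = refl

does-∈? : ∀ {m} (v : Fin m) (A : Subset m) → does (v ∈? A) ≡ lookup A v
does-∈? zero    (true Vec.∷ A)  = refl
does-∈? zero    (false Vec.∷ A) = refl
does-∈? (suc v) (_ Vec.∷ A)     = does-∈? v A

module FromGraph {n : ℕ} (G : Graph n) where

  open VertexSets n

  adjacency : Weight
  adjacency u v = ⟦ adj? G u v ⟧

  adjacent : ∀ {u v} → Adj G u v → adjacency u v ≡ 1
  adjacent {u} {v} uv with adj? G u v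
  ... | yes _ = refl
  ... | no ¬uv = contradiction uv ¬uv

  adjacency-isGraph : IsGraph adjacency
  adjacency-isGraph = record { symm = symm ; diag = diag }
    where
    symm : ∀ u v → adjacency u v ≡ adjacency v u
    symm u v with adj? G u v | adj? G v u
    ... | yes _  | yes _  = refl
    ... | no _   | no _   = refl
    ... | yes uv | no ¬vu = contradiction (Graph.sym G uv) ¬vu
    ... | no ¬uv | yes vu = contradiction (Graph.sym G vu) ¬uv
    diag : ∀ v → adjacency v v ≡ 0
    diag v with adj? G v v
    ... | yes vv = contradiction vv (loopless G)
    ... | no _   = refl

  adjacency≤1 : ∀ u v → adjacency u v ≤ 1
  adjacency≤1 u v with adj? G u v
  ... | yes _ = ≤-refl
  ... | no _  = z≤n

  size-lookup : ∀ {m} (A : Subset m) → VertexSets.size m (lookup A) ≡ ∣ A ∣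
  size-lookup Vec.[]          = refl
  size-lookup (true Vec.∷ A)  = cong suc (size-lookup A)
  size-lookup (false Vec.∷ A) = size-lookup A

  edgesIn≡edges : ∀ A → edgesIn G A ≡ edges adjacency (lookup A)
  edgesIn≡edges A = trans (sum-allFin (λ u → sumᴸ (map (entry u) (allFin n)))) (sum-cong-≗ λ u → trans (sum-allFin (entry u)) (trans
    (sum-cong-≗ (term u))
    (≡-sym (*-distribˡ-sum [ lookup A u ] (λ v → [ lookup A v ] * ([ u <ꟳ v ] * adjacency u v))))))
    where
    open ≡-Reasoning
    exch : ∀ l p q r → l * (p * (q * r)) ≡ p * (q * (l * r))
    exch l p q r = solve (l ∷ p ∷ q ∷ r ∷ [])
    entry : Fin n → Fin n → ℕ
    entry u v = ⟦ (toℕ u <? toℕ v) ×-dec ((u ∈? A) ×-dec ((v ∈? A) ×-dec adj? G u v)) ⟧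
    term : ∀ u v → entry u v ≡ [ lookup A u ] * ([ lookup A v ] * ([ u <ꟳ v ] * adjacency u v))
    term u v = begin
      ⟦ (toℕ u <? toℕ v) ×-dec ((u ∈? A) ×-dec ((v ∈? A) ×-dec adj? G u v)) ⟧
        ≡⟨ ⟦⟧≡[does] ((toℕ u <? toℕ v) ×-dec ((u ∈? A) ×-dec ((v ∈? A) ×-dec adj? G u v))) ⟩
      [ (u <ꟳ v) ∧ (does (u ∈? A) ∧ (does (v ∈? A) ∧ does (adj? G u v))) ]
        ≡⟨ cong₂ (λ p q → [ (u <ꟳ v) ∧ (p ∧ (q ∧ does (adj? G u v))) ]) (does-∈? u A) (does-∈? v A) ⟩
      [ (u <ꟳ v) ∧ (lookup A u ∧ (lookup A v ∧ does (adj? G u v))) ]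
        ≡⟨ trans ([∧] (u <ꟳ v) _) (cong ([ u <ꟳ v ] *_) (trans ([∧] (lookup A u) _) (cong ([ lookup A u ] *_) ([∧] (lookup A v) _)))) ⟩
      [ u <ꟳ v ] * ([ lookup A u ] * ([ lookup A v ] * [ does (adj? G u v) ]))
        ≡⟨ exch [ u <ꟳ v ] [ lookup A u ] [ lookup A v ] _ ⟩
      [ lookup A u ] * ([ lookup A v ] * ([ u <ꟳ v ] * [ does (adj? G u v) ]))
        ≡⟨ cong (λ x → [ lookup A u ] * ([ lookup A v ] * ([ u <ꟳ v ] * x))) (⟦⟧≡[does] (adj? G u v)) ⟨
      [ lookup A u ] * ([ lookup A v ] * ([ u <ꟳ v ] * adjacency u v)) ∎

  degIn≡⟨⟩ : ∀ A v → degIn G A v ≡ ⟨ lookup A , adjacency v ⟩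
  degIn≡⟨⟩ A v = trans (sum-allFin (λ u → ⟦ (u ∈? A) ×-dec adj? G v u ⟧)) (sum-cong-≗ λ u → trans
    (⟦⟧≡[does] ((u ∈? A) ×-dec adj? G v u))
    (trans ([∧] (does (u ∈? A)) _) (cong₂ (λ p q → [ p ] * q) (does-∈? u A) (≡-sym (⟦⟧≡[does] (adj? G v u))))))

  open GraphLemmas adjacency-isGraph

  -- Edge counts of paths and cycles.

  vertices : List (Fin n) → VSet
  vertices []       = ∅
  vertices (x ∷ xs) = vertices xs ∪ ｛ x ｝

  head∈ : ∀ x xs → x ∈ vertices (x ∷ xs)
  head∈ x xs = trans (cong (vertices xs x ∨_) (∈｛｝ x)) (∨-zeroʳ (vertices xs x))

  tail⊆ : ∀ x xs → vertices xs ⊆ vertices (x ∷ xs)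
  tail⊆ x xs = ∪⊇ˡ (vertices xs) ｛ x ｝

  ∉vertices : ∀ {x xs} → All (x ≢_) xs → vertices xs x ≡ false
  ∉vertices All.[]                         = refl
  ∉vertices {x} {y ∷ ys} (x≢y All.∷ x∉ys) = cong₂ _∨_ (∉vertices x∉ys) (∉｛｝ y x x≢y)

  vertices⊆ : ∀ {P xs} → All (λ v → v ∈ P) xs → vertices xs ⊆ P
  vertices⊆ All.[]                         v ()
  vertices⊆ {P} {x ∷ xs} (x∈P All.∷ xs⊆P) = ∪⊆ (vertices⊆ xs⊆P) λ v p → subst (_∈ P) (≡-sym (∈｛｝⇒≡ x v p)) x∈P

  vertices-split : ∀ {x xs} → All (x ≢_) xs → vertices (x ∷ xs) ≐ vertices xs ⊍ ｛ x ｝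
  vertices-split {x} {xs} x∉xs = split-∪ (vertices xs) ｛ x ｝ λ v p →
    subst (λ u → vertices xs u ≡ false) (≡-sym (∈｛｝⇒≡ x v p)) (∉vertices x∉xs)

  size-vertices : ∀ {xs} → Unique xs → size (vertices xs) ≡ length xs
  size-vertices AllPairs.[]                      = ⟨∅⟩ (const 1)
  size-vertices {x ∷ xs} (x∉xs AllPairs.∷ uniq) = trans (⟨⟩-split (const 1) (vertices-split x∉xs))
    (trans (cong₂ _+_ (size-vertices uniq) (⟨｛｝⟩ x (const 1))) (+-comm (length xs) 1))

  edges-vertices : ∀ {x xs} → All (x ≢_) xs →
    edges adjacency (vertices (x ∷ xs)) ≡ edges adjacency (vertices xs) + ⟨ vertices xs , adjacency x ⟩
  edges-vertices {x} {xs} x∉xs = trans (edges-split (vertices-split x∉xs)) (cong₂ _+_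
    (trans (cong (edges adjacency (vertices xs) +_) (edges-small ｛ x ｝ (≤-reflexive (⟨｛｝⟩ x (const 1))))) (+-identityʳ _))
    (⟨⟩-cong (vertices xs) λ v _ → trans (⟨｛｝⟩ x (adjacency v)) (IsGraph.symm adjacency-isGraph v x)))

  -- Each vertex put in front of a path adds at least its edge to the next one.
  path-edges : ∀ {x xs} → Unique (x ∷ xs) → Walk G (x ∷ xs) → length xs ≤ edges adjacency (vertices (x ∷ xs))
  path-edges {x} {[]}     _            _             = z≤n
  path-edges {x} {y ∷ ys} (x∉ AllPairs.∷ uniq) (xy , walk) = begin
    suc (length ys)                                   ≡⟨ +-comm 1 (length ys) ⟩
    length ys + 1                                     ≤⟨ +-mono-≤ (path-edges uniq walk) (≤-trans (≤-reflexive (≡-sym (adjacent xy))) (⟨⟩-∈ (vertices (y ∷ ys)) (adjacency x) (head∈ y ys))) ⟩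
    edges adjacency (vertices (y ∷ ys)) + ⟨ vertices (y ∷ ys) , adjacency x ⟩  ≡⟨ edges-vertices x∉ ⟨
    edges adjacency (vertices (x ∷ y ∷ ys)) ∎
    where open ≤-Reasoning

  -- Detaches the closing edge of a cycle from the path that it closes.
  split-last : ∀ {z} x xs → Walk G (x ∷ xs ++ z ∷ []) →
    Walk G (x ∷ xs) × ∃ λ l → l ∈ vertices (x ∷ xs) × Adj G l z
  split-last x []       (xz , _)    = _ , x , head∈ x [] , xz
  split-last x (y ∷ ys) (xy , walk) with split-last y ys walk
  ... | walk′ , l , l∈ , lz = (xy , walk′) , l , tail⊆ x (y ∷ ys) l l∈ , lz

  module _ (D : ℕ) where
    open Colour n D

    -- Besides the path through `vs`, with one edge fewer than vertices, there are two edges from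
    -- `v₀`, to the first and to the last vertex of `vs`. These differ because the last one is found
    -- in the tail `z ∷ zs`.
    cycle-edges : ∀ {v₀ vs} → Unique (v₀ ∷ vs) → 2 ≤ length vs → Walk G (v₀ ∷ vs ++ v₀ ∷ []) →
      size (vertices (v₀ ∷ vs)) ≤ edges adjacency (vertices (v₀ ∷ vs))
    cycle-edges {v₀} {y ∷ []}     _ (s≤s ()) _
    cycle-edges {v₀} {y ∷ z ∷ zs} uniq@(v₀∉ AllPairs.∷ uniq′@(y∉ AllPairs.∷ _)) _ (v₀y , yz , walk) with split-last z zs walk
    ... | walk′ , l , l∈ , lv₀ = begin
      size (vertices (v₀ ∷ vs))        ≡⟨ size-vertices uniq ⟩
      3 + length zs                    ≡⟨ +-comm 2 (suc (length zs)) ⟩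
      length (z ∷ zs) + 2              ≤⟨ +-mono-≤ (path-edges uniq′ (yz , walk′)) two ⟩
      edges adjacency (vertices vs) + ⟨ vertices vs , adjacency v₀ ⟩  ≡⟨ edges-vertices v₀∉ ⟨
      edges adjacency (vertices (v₀ ∷ vs)) ∎
      where
      open ≤-Reasoning
      vs : List (Fin n)
      vs = y ∷ z ∷ zs
      two : 2 ≤ ⟨ vertices vs , adjacency v₀ ⟩
      two = ≤-trans (≤-reflexive (cong₂ _+_ (≡-sym (adjacent v₀y)) (≡-sym (adjacent (Graph.sym G lv₀)))))
        (pair≤⟨⟩ (vertices vs) (adjacency v₀) (head∈ y (z ∷ zs)) (tail⊆ y (z ∷ zs) l l∈)
          (∉⇒≢ (vertices (z ∷ zs)) l∈ (∉vertices y∉) ∘ ≡-sym))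

    forest⇒acyclic : ∀ {P A} → (∀ v → v ∈ₛ A → v ∈ P) → Forest adjacency P → IsForest G A
    forest⇒acyclic {P} {A} A⊆P f v₀ vs (uniq , long , vs⊆A , walk) = <⇒≱
      (f (vertices (v₀ ∷ vs)) (vertices⊆ (All.map (λ {v} → A⊆P v) vs⊆A)) v₀ (head∈ v₀ vs))
      (cycle-edges uniq long walk)

-- Clearing denominators in the sparsity condition.

open import Data.Integer using (+_)
import Data.Integer as ℤ
import Data.Integer.Properties as ℤ
open import Data.Rational using (_/_; toℚᵘ)
import Data.Rational as ℚ
import Data.Rational.Properties as ℚ
import Data.Rational.Unnormalised as ℚᵘ
import Data.Rational.Unnormalised.Properties as ℚᵘ
open import Data.Rational.Unnormalised using (mkℚᵘ)

-- The quotient is stored in lowest terms; up to `≃` the original denominator is recovered.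
toℚᵘ-/ : ∀ c m → toℚᵘ ((+ c) / suc m) ℚᵘ.≃ mkℚᵘ (+ c) m
toℚᵘ-/ c m = ℚ.toℚᵘ-fromℚᵘ (mkℚᵘ (+ c) m)

toℚᵘ-affine : ∀ a x b → toℚᵘ (a ℚ.* x ℚ.+ b) ℚᵘ.≃ toℚᵘ a ℚᵘ.* toℚᵘ x ℚᵘ.+ toℚᵘ b
toℚᵘ-affine a x b = ℚᵘ.≃-trans (ℚ.toℚᵘ-homo-+ (a ℚ.* x) b) (ℚᵘ.+-cong (ℚ.toℚᵘ-homo-* a x) ℚᵘ.≃-refl)

-- Cross-multiplication multiplies the two equal denominators, leaving one surplus factor `suc m` to
-- cancel.
cleared : ∀ c s b m e → mkℚᵘ (+ e) 0 ℚᵘ.≤ mkℚᵘ (+ c) m ℚᵘ.* mkℚᵘ (+ s) 0 ℚᵘ.+ mkℚᵘ (+ b) m → suc m * e ≤ c * s + b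
cleared c s b m e (ℚᵘ.*≤* h) = *-cancelˡ-≤ (suc m) (begin
  suc m * (suc m * e)          ≡⟨ left m e ⟩
  e * (suc m * 1 * suc m)      ≤⟨ ℤ.drop‿+≤+ (subst₂ ℤ._≤_ lhs rhs h) ⟩
  (c * s * suc m + b * (suc m * 1)) * 1  ≡⟨ right c s b m ⟩
  suc m * (c * s + b) ∎)
  where
  open ≤-Reasoning
  left : ∀ m e → suc m * (suc m * e) ≡ e * (suc m * 1 * suc m)
  left m e = solve (m ∷ e ∷ [])
  right : ∀ c s b m → (c * s * suc m + b * (suc m * 1)) * 1 ≡ suc m * (c * s + b)
  right c s b m = solve (c ∷ s ∷ b ∷ m ∷ [])
  lhs : (+ e) ℤ.* (+ (suc m * 1 * suc m)) ≡ + (e * (suc m * 1 * suc m))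
  lhs = ≡-sym (ℤ.pos-* e (suc m * 1 * suc m))
  rhs : ((+ c) ℤ.* (+ s) ℤ.* (+ suc m) ℤ.+ (+ b) ℤ.* (+ (suc m * 1))) ℤ.* + 1 ≡ + ((c * s * suc m + b * (suc m * 1)) * 1)
  rhs = trans
    (cong (ℤ._* + 1) (trans
      (cong₂ ℤ._+_
        (trans (cong (ℤ._* + suc m) (≡-sym (ℤ.pos-* c s))) (≡-sym (ℤ.pos-* (c * s) (suc m))))
        (≡-sym (ℤ.pos-* b (suc m * 1))))
      (≡-sym (ℤ.pos-+ (c * s * suc m) (b * (suc m * 1))))))
    (≡-sym (ℤ.pos-* (c * s * suc m + b * (suc m * 1)) 1))

affine-≤ : ∀ {p a x b p′ a′ x′ b′} → toℚᵘ p ℚᵘ.≃ p′ → toℚᵘ a ℚᵘ.≃ a′ → toℚᵘ x ℚᵘ.≃ x′ → toℚᵘ b ℚᵘ.≃ b′ →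
  p ℚ.≤ a ℚ.* x ℚ.+ b → p′ ℚᵘ.≤ a′ ℚᵘ.* x′ ℚᵘ.+ b′
affine-≤ {p} {a} {x} {b} p≃ a≃ x≃ b≃ h = ℚᵘ.≤-respˡ-≃ p≃ (ℚᵘ.≤-respʳ-≃
  (ℚᵘ.≃-trans (toℚᵘ-affine a x b) (ℚᵘ.+-cong (ℚᵘ.*-cong a≃ x≃) b≃)) (ℚ.toℚᵘ-mono-≤ h))

clear-denominators : ∀ c s b m e →
  (+ e) / 1 ℚ.≤ (+ c) / suc m ℚ.* ((+ s) / 1) ℚ.+ (+ b) / suc m → suc m * e ≤ c * s + b
clear-denominators c s b m e h = cleared c s b m e
  (affine-≤ {p = (+ e) / 1} {a = (+ c) / suc m} {x = (+ s) / 1} {b = (+ b) / suc m} (toℚᵘ-/ e 0) (toℚᵘ-/ c m) (toℚᵘ-/ s 0) (toℚᵘ-/ b m) h)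

-- The theorem, from the typed version with all types 0.

theorem1p2 : (D : ℕ) → 2 ≤ D → (n : ℕ) → (G : Graph n) →
    Sparse ((+ (6 * D + 5)) / (3 * suc D)) ((+ 2) / (3 * suc D)) G →
    Σ (Subset n) (λ M → DFColoring G D M)
theorem1p2 D 2≤D n G sparse = tabulate c , forest⇒acyclic D ∈M forestM , degrees , forest⇒acyclic D ∈F forestF
  where
  open VertexSets n
  open Colour n D
  open FromGraph G

  V : VSet
  V = const true

  -- The given sparsity concerns sets with at least two vertices; smaller ones span no edge.
  sparseⱼ : Sparseⱼ adjacency (const 0) V
  sparseⱼ P _ with 2 ≤? size P
  ... | no ¬two = ≤-trans (≤-reflexive (trans
      (cong₂ (λ e t → 3 * suc D * e + 3 * t) (GraphLemmas.edges-small adjacency-isGraph P (≤-pred (≰⇒> ¬two))) (⟨⟩-zero P λ _ _ → refl))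
      (trans (+-identityʳ _) (*-zeroʳ (3 * suc D))))) z≤n
  ... | yes two = begin
    3 * suc D * edges adjacency P + 3 * ⟨ P , const 0 ⟩   ≡⟨ cong (λ t → 3 * suc D * edges adjacency P + 3 * t) (⟨⟩-zero P λ _ _ → refl) ⟩
    3 * suc D * edges adjacency P + 0                     ≡⟨ +-identityʳ _ ⟩
    3 * suc D * edges adjacency P                         ≡⟨ cong (3 * suc D *_) (edges-≗ adjacency (lookup∘tabulate P)) ⟨
    3 * suc D * edges adjacency (lookup A)                ≡⟨ cong (3 * suc D *_) (edgesIn≡edges A) ⟨
    -- `D + 2 * suc D` is the predecessor of the denominator `3 * suc D`.
    3 * suc D * edgesIn G A                               ≤⟨ clear-denominators (6 * D + 5) ∣ A ∣ 2 (D + 2 * suc D) (edgesIn G A) (sparse A (subst (2 ≤_) (≡-sym ∣A∣≡) two)) ⟩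
    (6 * D + 5) * ∣ A ∣ + 2                               ≡⟨ cong (λ s → (6 * D + 5) * s + 2) ∣A∣≡ ⟩
    W P + 2 ∎
    where
    open ≤-Reasoning
    A : Subset n
    A = tabulate P
    ∣A∣≡ : ∣ A ∣ ≡ size P
    ∣A∣≡ = trans (≡-sym (size-lookup A)) (⟨⟩-≗ (const 1) (lookup∘tabulate P))

  colouring : ∃ (Colouring adjacency (const 0) V)
  colouring = Induction.colour n D 2≤D (size V) ≤-refl record
    { isGraph = adjacency-isGraph
    ; simple  = λ u v _ _ → adjacency≤1 u v
    ; j≤1+D   = λ _ → z≤n
    ; sparse  = sparseⱼ
    }

  c : VSet
  c = proj₁ colouring

  open Colouring (proj₂ colouring)

  ∈M : ∀ v → v ∈ₛ tabulate c → v ∈ V ∩ c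
  ∈M v p = trans (≡-sym (lookup∘tabulate c v)) ([]=⇒lookup p)

  ∈F : ∀ v → v ∈ₛ ∁ (tabulate c) → v ∈ V ∖ c
  ∈F v p = ∈∖ V c refl (¬-not λ q → x∈∁p⇒x∉p p (lookup⇒[]= v (tabulate c) (trans (lookup∘tabulate c v) q)))

  degrees : MaxDegreeAtMost G (tabulate c) D
  degrees v p = ≤-trans
    (≤-reflexive (trans (degIn≡⟨⟩ (tabulate c) v) (⟨⟩-≗ (adjacency v) (lookup∘tabulate c))))
    (degM v (∈M v p))
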